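{- Let $n\ge 1$ and let $A[0..n)$ be an array of $n$ elements from a totally ordered set, whose runs have respective lengths $L_1,\dots,L_r$ (so $L_i\ge 1$ and $L_1+\dots+L_r=n$). Let $M$ be the mergecost of running top-down Mergesort with sorted check, i.e. the procedure $\mathrm{Mergesort}(A[0..n))$ defined in the context, on this input. Then $$M \;\le\; (\mathcal H+3)\,n, \qquad\text{where}\qquad \mathcal H=\sum_{i=1}^{r}\frac{L_i}{n}\log_2\frac{n}{L_i}.$$
   Context: Notation: $A[l..r)$ denotes the contiguous subarray of $A$ consisting of the entries with indices $l,l+1,\dots,r-1$. Runs: the runs of the input array $A[0..n)$ are its maximal (weakly) increasing contiguous subranges. That is, the index range $[0..n)$ is partitioned into consecutive nonempty intervals by cutting between positions $j-1$ and $j$ exactly when $A[j-1]>A[j]$ in the initial input ($1\le j<n$). The runs are the resulting intervals, and $L_1,\dots,L_r$ are their sizes from left to right. Algorithm: top-down Mergesort with sorted check is the following recursive in-place procedure. $\mathrm{Mergesort}(A[l..r))$: 1. Let $s=r-l$. If $s\le 1$, return. 2. Let $m=l+\lfloor s/2\rfloor$. 3. Call $\mathrm{Mergesort}(A[l..m))$. 4. Call $\mathrm{Mergesort}(A[m..r))$. 5. If (for the current array contents) $A[m-1]>A[m]$, then merge the two sorted subarrays $A[l..m)$ and $A[m..r)$ so that $A[l..r)$ becomes the sorted arrangement of its elements. Otherwise, do nothing. Mergecost: each merge actually performed in step 5 on $A[l..r)$ has output size $r-l$. The mergecost $M$ of an execution is the sum of the output sizes of all merges performed during the execution, including all recursive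 calls. The quantity $\mathcal H$ is called the runlength entropy of the input. -}

module Defs where

open import Data.Bool.Base using (Bool; true; false; not; if_then_else_)
open import Data.Integer.Base as ℤ using (ℤ; +_; -[1+_]; +[1+_]; +≤+; ∣_∣)
import Data.Integer.Properties as ℤ
import Data.Integer.Solver as ℤS
open import Data.List.Base as List using (List; []; _∷_; length; take; drop; merge; foldr; _++_)
import Data.List.Properties as List
open import Data.List.NonEmpty.Base as List⁺ using (List⁺; _∷_)
open import Data.Maybe.Base using (just)
open import Data.Nat.Base as ℕ using (ℕ; zero; suc; NonZero; ⌊_/2⌋; s≤s; z≤n)
open import Data.Nat.Induction using (Acc; acc; <-wellFounded)
import Data.Nat.Properties as ℕ
import Data.Nat.Solver as ℕS
open import Data.Product.Base using (_×_; _,_; ∃-syntax; proj₂)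
open import Data.Rational.Unnormalised.Base as ℚ
  using (ℚᵘ; mkℚᵘ; ↥_; ↧_; ↧ₙ_; *≤*; *<*; *≡*; Positive; _≃_; 1/_)
import Data.Rational.Unnormalised.Properties as ℚ
open import Relation.Binary.Bundles using (DecTotalOrder)
open import Relation.Binary.PropositionalEquality
  using (_≡_; refl; sym; trans; cong; cong₂; subst₂)
open import Relation.Nullary using (¬_; does; yes; no; contradiction)

-- Two-sided Dedekind cuts of the rationals.  `located` is the arithmetical form
-- of locatedness; with ε = 1 it also gives inhabitedness of both sides.
record ℝ : Set₁ where
  field
    L U       : ℚᵘ → Set
    L-closed  : ∀ {p q} → p ℚ.≤ q → L q → L p
    U-closed  : ∀ {p q} → p ℚ.≤ q → U p → U q
    L-open    : ∀ {q} → L q → ∃[ r ] (q ℚ.< r × L r)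
    U-open    : ∀ {q} → U q → ∃[ r ] (r ℚ.< q × U r)
    separated : ∀ {p q} → L p → U q → p ℚ.< q
    located   : ∀ ε → Positive ε → ∃[ q ] (L q × U (q ℚ.+ ε))

open ℝ

infix 4 _<_ _≤_

_<_ : ℝ → ℝ → Set
x < y = ∃[ q ] (U x q × L y q)

_≤_ : ℝ → ℝ → Set
x ≤ y = ¬ (y < x)

ε/2+ε/2 : ∀ ε → ℚ.½ ℚ.* ε ℚ.+ ℚ.½ ℚ.* ε ≃ ε
ε/2+ε/2 ε = ℚ.≃-trans (ℚ.≃-sym (ℚ.*-distribʳ-+ ε ℚ.½ ℚ.½))
              (ℚ.≃-trans (ℚ.*-congʳ {ε} (*≡* {ℚ.½ ℚ.+ ℚ.½} {ℚ.1ℚᵘ} refl))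
                         (ℚ.*-identityˡ ε))

half-pos : ∀ ε → Positive ε → Positive (ℚ.½ ℚ.* ε)
half-pos ε ε>0 = ℚ.pos*pos⇒pos ℚ.½ ε {{ε>0}}

p<p+ε : ∀ p {ε} → Positive ε → p ℚ.< p ℚ.+ ε
p<p+ε p {ε} ε>0 = begin-strict
    p             ≃⟨ ℚ.≃-sym (ℚ.+-identityʳ p) ⟩
    p ℚ.+ ℚ.0ℚᵘ   <⟨ ℚ.+-monoʳ-< p (ℚ.positive⁻¹ ε {{ε>0}}) ⟩
    p ℚ.+ ε       ∎
  where open ℚ.≤-Reasoning

interchange : ∀ a b c d → (a ℚ.+ b) ℚ.+ (c ℚ.+ d) ≃ (a ℚ.+ c) ℚ.+ (b ℚ.+ d)
interchange = solve 4 (λ a b c d → (a :+ b) :+ (c :+ d) := (a :+ c) :+ (b :+ d)) ℚ.≃-refl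
  where open import Data.Rational.Unnormalised.Solver
        open +-*-Solver

fromℚ : ℚᵘ → ℝ
fromℚ c = record
  { L = ℚ._< c
  ; U = c ℚ.<_
  ; L-closed  = ℚ.≤-<-trans
  ; U-closed  = λ p≤q c<p → ℚ.<-≤-trans c<p p≤q
  ; L-open    = λ q<c → ℚ.<-dense q<c
  ; U-open    = λ c<q → let r , c<r , r<q = ℚ.<-dense c<q in r , r<q , c<r
  ; separated = ℚ.<-trans
  ; located   = λ ε ε>0 →
      let δ   = ℚ.½ ℚ.* ε
          δ>0 = half-pos ε ε>0
          back : c ℚ.- δ ℚ.+ δ ≃ c
          back = ℚ.≃-trans (ℚ.+-assoc c (ℚ.- δ) δ)
                   (ℚ.≃-trans (ℚ.+-congʳ c (ℚ.+-inverseˡ δ)) (ℚ.+-identityʳ c))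
          split : c ℚ.+ δ ≃ c ℚ.- δ ℚ.+ ε
          split = ℚ.≃-trans (ℚ.+-congˡ δ (ℚ.≃-sym back))
                    (ℚ.≃-trans (ℚ.+-assoc (c ℚ.- δ) δ δ) (ℚ.+-congʳ (c ℚ.- δ) (ε/2+ε/2 ε)))
      in c ℚ.- δ
         , ℚ.<-respʳ-≃ back (p<p+ε (c ℚ.- δ) δ>0)
         , ℚ.<-respʳ-≃ split (p<p+ε c δ>0)
  }

fromℕ : ℕ → ℝ
fromℕ k = fromℚ (+ k ℚ./ 1)

infixl 6 _+_

_+_ : ℝ → ℝ → ℝ
x + y = record
  { L = λ q → ∃[ r ] ∃[ s ] (L x r × L y s × q ℚ.≤ r ℚ.+ s)
  ; U = λ q → ∃[ r ] ∃[ s ] (U x r × U y s × r ℚ.+ s ℚ.≤ q)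
  ; L-closed  = λ { p≤q (r , s , Lr , Ls , q≤r+s) → r , s , Lr , Ls , ℚ.≤-trans p≤q q≤r+s }
  ; U-closed  = λ { p≤q (r , s , Ur , Us , r+s≤p) → r , s , Ur , Us , ℚ.≤-trans r+s≤p p≤q }
  ; L-open    = λ { (r , s , Lr , Ls , q≤r+s) →
      let r′ , r<r′ , Lr′ = L-open x Lr
          s′ , s<s′ , Ls′ = L-open y Ls
      in r′ ℚ.+ s′ , ℚ.≤-<-trans q≤r+s (ℚ.+-mono-< r<r′ s<s′)
         , r′ , s′ , Lr′ , Ls′ , ℚ.≤-refl }
  ; U-open    = λ { (r , s , Ur , Us , r+s≤q) →
      let r′ , r′<r , Ur′ = U-open x Ur
          s′ , s′<s , Us′ = U-open y Us
      in r′ ℚ.+ s′ , ℚ.<-≤-trans (ℚ.+-mono-< r′<r s′<s) r+s≤q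
         , r′ , s′ , Ur′ , Us′ , ℚ.≤-refl }
  ; separated = λ { (r , s , Lr , Ls , p≤r+s) (r′ , s′ , Ur′ , Us′ , r′+s′≤q) →
      ℚ.≤-<-trans p≤r+s
        (ℚ.<-≤-trans (ℚ.+-mono-< (separated x Lr Ur′) (separated y Ls Us′)) r′+s′≤q) }
  ; located   = λ ε ε>0 →
      let δ = ℚ.½ ℚ.* ε
          r , Lr , Ur = located x δ (half-pos ε ε>0)
          s , Ls , Us = located y δ (half-pos ε ε>0)
      in r ℚ.+ s , (r , s , Lr , Ls , ℚ.≤-refl)
         , (r ℚ.+ δ , s ℚ.+ δ , Ur , Us
           , ℚ.≤-reflexive (ℚ.≃-trans (interchange r δ s δ)
                              (ℚ.+-congʳ (r ℚ.+ s) (ε/2+ε/2 ε))))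
  }

record ℚ⁺ : Set where
  field
    value        : ℚᵘ
    {{positive}} : Positive value

infixl 8 _/_

_/_ : (a b : ℕ) .{{_ : NonZero a}} .{{_ : NonZero b}} → ℚ⁺
suc a / b@(suc _) = record { value = + suc a ℚ./ b }

infixr 7 _•_

_•_ : ℚ⁺ → ℝ → ℝ
record { value = c } • x = record
  { L = λ q → ∃[ r ] (L x r × q ℚ.≤ c ℚ.* r)
  ; U = λ q → ∃[ r ] (U x r × c ℚ.* r ℚ.≤ q)
  ; L-closed  = λ { p≤q (r , Lr , q≤cr) → r , Lr , ℚ.≤-trans p≤q q≤cr }
  ; U-closed  = λ { p≤q (r , Ur , cr≤p) → r , Ur , ℚ.≤-trans cr≤p p≤q }
  ; L-open    = λ { (r , Lr , q≤cr) →
      let r′ , r<r′ , Lr′ = L-open x Lr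
      in c ℚ.* r′ , ℚ.≤-<-trans q≤cr (ℚ.*-monoʳ-<-pos c r<r′) , r′ , Lr′ , ℚ.≤-refl }
  ; U-open    = λ { (r , Ur , cr≤q) →
      let r′ , r′<r , Ur′ = U-open x Ur
      in c ℚ.* r′ , ℚ.<-≤-trans (ℚ.*-monoʳ-<-pos c r′<r) cr≤q , r′ , Ur′ , ℚ.≤-refl }
  ; separated = λ { (r , Lr , p≤cr) (r′ , Ur′ , cr′≤q) →
      ℚ.≤-<-trans p≤cr (ℚ.<-≤-trans (ℚ.*-monoʳ-<-pos c (separated x Lr Ur′)) cr′≤q) }
  ; located   = λ ε ε>0 →
      let instance _ = ℚ.pos⇒nonZero c
          δ   = 1/ c ℚ.* ε
          δ>0 = ℚ.pos*pos⇒pos (1/ c) {{ℚ.1/pos⇒pos c}} ε {{ε>0}}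
          cδ≃ε : c ℚ.* δ ≃ ε
          cδ≃ε = ℚ.≃-trans (ℚ.≃-sym (ℚ.*-assoc c (1/ c) ε))
                   (ℚ.≃-trans (ℚ.*-congʳ {ε} (ℚ.*-inverseʳ c)) (ℚ.*-identityˡ ε))
          r , Lr , Ur = located x δ δ>0
      in c ℚ.* r , (r , Lr , ℚ.≤-refl)
         , (r ℚ.+ δ , Ur
           , ℚ.≤-reflexive (ℚ.≃-trans (ℚ.*-distribˡ-+ c r δ) (ℚ.+-congʳ (c ℚ.* r) cδ≃ε)))
  }

∑ : ∀ {a} {A : Set a} → List A → (A → ℝ) → ℝ
∑ xs f = foldr (λ x s → f x + s) (fromℕ 0) xs

pos neg : ℤ → ℕ
pos (+ n)    = n
pos -[1+ n ] = 0
neg z = pos (ℤ.- z)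

-- For q = p/d and x = a/b > 0:  2^q < x  iff  2^p b^d < a^d.  A negative p is
-- moved to the other side, so that all exponents are natural numbers.
_<ₗ_ _>ₗ_ : ℚᵘ → ℚᵘ → Set
q <ₗ x = 2 ℕ.^ pos (↥ q) ℕ.* ↧ₙ x ℕ.^ ↧ₙ q ℕ.< 2 ℕ.^ neg (↥ q) ℕ.* ∣ ↥ x ∣ ℕ.^ ↧ₙ q
q >ₗ x = 2 ℕ.^ neg (↥ q) ℕ.* ∣ ↥ x ∣ ℕ.^ ↧ₙ q ℕ.< 2 ℕ.^ pos (↥ q) ℕ.* ↧ₙ x ℕ.^ ↧ₙ q

module Log where

  -- 2^((u-v)/d) < A/B
  P : (u v d A B : ℕ) → Set
  P u v d A B = 2 ℕ.^ u ℕ.* B ℕ.^ d ℕ.< 2 ℕ.^ v ℕ.* A ℕ.^ d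

  ^-distribʳ-* : ∀ m n k → (m ℕ.* n) ℕ.^ k ≡ m ℕ.^ k ℕ.* n ℕ.^ k
  ^-distribʳ-* m n zero    = refl
  ^-distribʳ-* m n (suc k) rewrite ^-distribʳ-* m n k =
    solve 4 (λ a b c d → a :* b :* (c :* d) := a :* c :* (b :* d)) refl m n (m ℕ.^ k) (n ℕ.^ k)
    where open ℕS.+-*-Solver

  powP : ∀ u B d k → (2 ℕ.^ u ℕ.* B ℕ.^ d) ℕ.^ k ≡ 2 ℕ.^ (u ℕ.* k) ℕ.* B ℕ.^ (d ℕ.* k)
  powP u B d k = trans (^-distribʳ-* (2 ℕ.^ u) (B ℕ.^ d) k)
                       (cong₂ ℕ._*_ (ℕ.^-*-assoc 2 u k) (ℕ.^-*-assoc B d k))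

  unpow-< : ∀ k {m n} → m ℕ.^ k ℕ.< n ℕ.^ k → m ℕ.< n
  unpow-< k {m} {n} lt with m ℕ.<? n
  ... | yes m<n = m<n
  ... | no  m≮n = contradiction (ℕ.<-≤-trans lt (ℕ.^-monoˡ-≤ k (ℕ.≮⇒≥ m≮n))) (ℕ.<-irrefl refl)

  mono : ∀ {u v u′ v′ A B} d d′ .{{_ : NonZero d}} →
         u ℕ.* d′ ℕ.+ v′ ℕ.* d ℕ.≤ u′ ℕ.* d ℕ.+ v ℕ.* d′ →
         P u′ v′ d′ A B → P u v d A B
  mono {u} {v} {u′} {v′} {A} {B} d d′ le h = unpow-< d′ (subst₂ ℕ._<_
      (sym (powP u B d d′)) (sym (powP v A d d′)) goal)
    where
    open ℕ.≤-Reasoning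
    h^d : 2 ℕ.^ (u′ ℕ.* d) ℕ.* B ℕ.^ (d′ ℕ.* d) ℕ.< 2 ℕ.^ (v′ ℕ.* d) ℕ.* A ℕ.^ (d′ ℕ.* d)
    h^d = subst₂ ℕ._<_ (powP u′ B d′ d) (powP v′ A d′ d) (ℕ.^-monoˡ-< d h)
    shift : ∀ e f z → 2 ℕ.^ e ℕ.* (2 ℕ.^ f ℕ.* z) ≡ 2 ℕ.^ (e ℕ.+ f) ℕ.* z
    shift e f z = trans (sym (ℕ.*-assoc (2 ℕ.^ e) (2 ℕ.^ f) z))
                        (cong (ℕ._* z) (sym (ℕ.^-distribˡ-+-* 2 e f)))
    goal : 2 ℕ.^ (u ℕ.* d′) ℕ.* B ℕ.^ (d ℕ.* d′) ℕ.< 2 ℕ.^ (v ℕ.* d′) ℕ.* A ℕ.^ (d ℕ.* d′)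
    goal = ℕ.*-cancelˡ-< (2 ℕ.^ (v′ ℕ.* d)) _ _ (begin-strict
      2 ℕ.^ (v′ ℕ.* d) ℕ.* (2 ℕ.^ (u ℕ.* d′) ℕ.* B ℕ.^ (d ℕ.* d′))
        ≡⟨ shift (v′ ℕ.* d) (u ℕ.* d′) _ ⟩
      2 ℕ.^ (v′ ℕ.* d ℕ.+ u ℕ.* d′) ℕ.* B ℕ.^ (d ℕ.* d′)
        ≤⟨ ℕ.*-monoˡ-≤ (B ℕ.^ (d ℕ.* d′)) (ℕ.^-monoʳ-≤ 2
             (subst₂ ℕ._≤_ (ℕ.+-comm (u ℕ.* d′) (v′ ℕ.* d)) (ℕ.+-comm (u′ ℕ.* d) (v ℕ.* d′)) le)) ⟩
      2 ℕ.^ (v ℕ.* d′ ℕ.+ u′ ℕ.* d) ℕ.* B ℕ.^ (d ℕ.* d′)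
        ≡⟨ cong (λ e → 2 ℕ.^ (v ℕ.* d′ ℕ.+ u′ ℕ.* d) ℕ.* B ℕ.^ e) (ℕ.*-comm d d′) ⟩
      2 ℕ.^ (v ℕ.* d′ ℕ.+ u′ ℕ.* d) ℕ.* B ℕ.^ (d′ ℕ.* d)
        ≡⟨ sym (shift (v ℕ.* d′) (u′ ℕ.* d) _) ⟩
      2 ℕ.^ (v ℕ.* d′) ℕ.* (2 ℕ.^ (u′ ℕ.* d) ℕ.* B ℕ.^ (d′ ℕ.* d))
        <⟨ ℕ.*-monoʳ-< (2 ℕ.^ (v ℕ.* d′)) {{ℕ.m^n≢0 2 (v ℕ.* d′)}} h^d ⟩
      2 ℕ.^ (v ℕ.* d′) ℕ.* (2 ℕ.^ (v′ ℕ.* d) ℕ.* A ℕ.^ (d′ ℕ.* d))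
        ≡⟨ shift (v ℕ.* d′) (v′ ℕ.* d) _ ⟩
      2 ℕ.^ (v ℕ.* d′ ℕ.+ v′ ℕ.* d) ℕ.* A ℕ.^ (d′ ℕ.* d)
        ≡⟨ cong₂ (λ e f → 2 ℕ.^ e ℕ.* A ℕ.^ f) (ℕ.+-comm (v ℕ.* d′) (v′ ℕ.* d)) (ℕ.*-comm d′ d) ⟩
      2 ℕ.^ (v′ ℕ.* d ℕ.+ v ℕ.* d′) ℕ.* A ℕ.^ (d ℕ.* d′)
        ≡⟨ sym (shift (v′ ℕ.* d) (v ℕ.* d′) _) ⟩
      2 ℕ.^ (v′ ℕ.* d) ℕ.* (2 ℕ.^ (v ℕ.* d′) ℕ.* A ℕ.^ (d ℕ.* d′)) ∎)

  pos-neg : ∀ z → z ≡ + pos z ℤ.- + neg z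
  pos-neg (+ zero)  = refl
  pos-neg +[1+ n ]  = sym (ℤ.+-identityʳ _)
  pos-neg -[1+ n ]  = refl

  -- (u-v)/d ≤ (u′-v′)/d′
  cross : ∀ u v d u′ v′ d′ →
          (+ u ℤ.- + v) ℤ.* + d′ ℤ.≤ (+ u′ ℤ.- + v′) ℤ.* + d →
          u ℕ.* d′ ℕ.+ v′ ℕ.* d ℕ.≤ u′ ℕ.* d ℕ.+ v ℕ.* d′
  cross u v d u′ v′ d′ le = ℤ.drop‿+≤+ (subst₂ ℤ._≤_
      (trans (solve 6 (λ u v d u′ v′ d′ →
                (u :- v) :* d′ :+ (v :* d′ :+ v′ :* d) := u :* d′ :+ v′ :* d)
              refl (+ u) (+ v) (+ d) (+ u′) (+ v′) (+ d′))
             (cast u d′ v′ d))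
      (trans (solve 6 (λ u v d u′ v′ d′ →
                (u′ :- v′) :* d :+ (v :* d′ :+ v′ :* d) := u′ :* d :+ v :* d′)
              refl (+ u) (+ v) (+ d) (+ u′) (+ v′) (+ d′))
             (cast u′ d v d′))
      (ℤ.+-monoˡ-≤ (+ v ℤ.* + d′ ℤ.+ + v′ ℤ.* + d) le))
    where
    open ℤS.+-*-Solver
    cast : ∀ a b c e → + a ℤ.* + b ℤ.+ + c ℤ.* + e ≡ + (a ℕ.* b ℕ.+ c ℕ.* e)
    cast a b c e = cong₂ ℤ._+_ (sym (ℤ.pos-* a b)) (sym (ℤ.pos-* c e))

  crossℚ : ∀ {p q} → p ℚ.≤ q →
           pos (↥ p) ℕ.* ↧ₙ q ℕ.+ neg (↥ q) ℕ.* ↧ₙ p ℕ.≤ pos (↥ q) ℕ.* ↧ₙ p ℕ.+ neg (↥ p) ℕ.* ↧ₙ q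
  crossℚ {p} {q} (*≤* le) =
    cross (pos (↥ p)) (neg (↥ p)) (↧ₙ p) (pos (↥ q)) (neg (↥ q)) (↧ₙ q)
      (subst₂ (λ a b → a ℤ.* ↧ q ℤ.≤ b ℤ.* ↧ p) (pos-neg (↥ p)) (pos-neg (↥ q)) le)

  flip-≤ : ∀ a b c d → a ℕ.+ b ℕ.≤ c ℕ.+ d → b ℕ.+ a ℕ.≤ d ℕ.+ c
  flip-≤ a b c d = subst₂ ℕ._≤_ (ℕ.+-comm a b) (ℕ.+-comm c d)

  lower : ∀ x {p q} → p ℚ.≤ q → q <ₗ x → p <ₗ x
  lower x {p} {q} p≤q =
    mono {pos (↥ p)} {neg (↥ p)} {pos (↥ q)} {neg (↥ q)} {∣ ↥ x ∣} {↧ₙ x} (↧ₙ p) (↧ₙ q) (crossℚ p≤q)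

  upper : ∀ x {p q} → p ℚ.≤ q → p >ₗ x → q >ₗ x
  upper x {p} {q} p≤q =
    mono {neg (↥ q)} {pos (↥ q)} {neg (↥ p)} {pos (↥ p)} {↧ₙ x} {∣ ↥ x ∣} (↧ₙ q) (↧ₙ p)
      (flip-≤ (pos (↥ p) ℕ.* ↧ₙ q) (neg (↥ q) ℕ.* ↧ₙ p)
              (pos (↥ q) ℕ.* ↧ₙ p) (neg (↥ p) ℕ.* ↧ₙ q) (crossℚ p≤q))

  sep : ∀ x {p q} → p <ₗ x → q >ₗ x → p ℚ.< q
  sep x {p} {q} p<x q>x with q ℚ.≤? p
  ... | yes q≤p = contradiction (lower x q≤p p<x) (ℕ.<-asym q>x)
  ... | no  q≰p = ℚ.≰⇒> q≰p

  frac : (u v d : ℕ) .{{_ : NonZero d}} → ℚᵘ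
  frac u v d = (+ u ℤ.- + v) ℚ./ d

  parts : ∀ u v z → + u ℤ.- + v ≡ z → u ℕ.+ neg z ≡ pos z ℕ.+ v
  parts u v z eq = ℤ.+-injective (trans (trans
      (solve 3 (λ u v n → u :+ n := (u :- v) :+ (v :+ n)) refl (+ u) (+ v) (+ neg z))
      (cong (ℤ._+ (+ v ℤ.+ + neg z)) (trans eq (pos-neg z))))
      (solve 3 (λ p n v → (p :- n) :+ (v :+ n) := p :+ v) refl (+ pos z) (+ neg z) (+ v)))
    where open ℤS.+-*-Solver

  parts* : ∀ u v d →
           let z = + u ℤ.- + v in pos z ℕ.* d ℕ.+ v ℕ.* d ≡ u ℕ.* d ℕ.+ neg z ℕ.* d
  parts* u v d = trans (sym (ℕ.*-distribʳ-+ d (pos z) v))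
      (trans (cong (ℕ._* d) (sym (parts u v z refl))) (ℕ.*-distribʳ-+ d u (neg z)))
    where z = + u ℤ.- + v

  P⇒<ₗ : ∀ x u v d .{{_ : NonZero d}} → P u v d ∣ ↥ x ∣ (↧ₙ x) → frac u v d <ₗ x
  P⇒<ₗ x u v d@(suc _) =
    let z = + u ℤ.- + v in
    mono {pos z} {neg z} {u} {v} {∣ ↥ x ∣} {↧ₙ x} d d (ℕ.≤-reflexive (parts* u v d))

  P⇒>ₗ : ∀ x u v d .{{_ : NonZero d}} → P v u d (↧ₙ x) ∣ ↥ x ∣ → frac u v d >ₗ x
  P⇒>ₗ x u v d@(suc _) =
    let z = + u ℤ.- + v in
    mono {neg z} {pos z} {v} {u} {↧ₙ x} {∣ ↥ x ∣} d d
      (flip-≤ (u ℕ.* d) (neg z ℕ.* d) (pos z ℕ.* d) (v ℕ.* d)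
        (ℕ.≤-reflexive (sym (parts* u v d))))

  bernoulli : ∀ m k → m ℕ.^ k ℕ.* (m ℕ.+ k) ℕ.≤ suc m ℕ.^ k ℕ.* m
  bernoulli m zero    = ℕ.≤-reflexive (cong (λ t → 1 ℕ.* t) (ℕ.+-identityʳ m))
  bernoulli m (suc k) = begin
      m ℕ.* m ℕ.^ k ℕ.* (m ℕ.+ suc k)
        ≤⟨ ℕ.m≤m+n _ (m ℕ.^ k ℕ.* k) ⟩
      m ℕ.* m ℕ.^ k ℕ.* (m ℕ.+ suc k) ℕ.+ m ℕ.^ k ℕ.* k
        ≡⟨ solve 3 (λ m e k → m :* e :* (m :+ (con 1 :+ k)) :+ e :* k
                              := (con 1 :+ m) :* (e :* (m :+ k))) refl m (m ℕ.^ k) k ⟩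
      suc m ℕ.* (m ℕ.^ k ℕ.* (m ℕ.+ k))
        ≤⟨ ℕ.*-monoʳ-≤ (suc m) (bernoulli m k) ⟩
      suc m ℕ.* (suc m ℕ.^ k ℕ.* m)
        ≡⟨ sym (ℕ.*-assoc (suc m) (suc m ℕ.^ k) m) ⟩
      suc m ℕ.* suc m ℕ.^ k ℕ.* m ∎
    where open ℕ.≤-Reasoning
          open ℕS.+-*-Solver

  double : ∀ m .{{_ : NonZero m}} {n} → m ℕ.< n → 2 ℕ.* m ℕ.^ (2 ℕ.* m) ℕ.< n ℕ.^ (2 ℕ.* m)
  double m {n} m<n = ℕ.<-≤-trans
      (ℕ.*-cancelʳ-< m _ _ (begin-strict
        2 ℕ.* e ℕ.* m                  <⟨ ℕ.m<m+n (2 ℕ.* e ℕ.* m) (ℕ.>-nonZero⁻¹ (e ℕ.* m) {{ℕ.m*n≢0 e m {{ℕ.m^n≢0 m (2 ℕ.* m)}}}}) ⟩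
        2 ℕ.* e ℕ.* m ℕ.+ e ℕ.* m      ≡⟨ solve 2 (λ e m → con 2 :* e :* m :+ e :* m := e :* (m :+ con 2 :* m)) refl e m ⟩
        e ℕ.* (m ℕ.+ 2 ℕ.* m)          ≤⟨ bernoulli m (2 ℕ.* m) ⟩
        suc m ℕ.^ (2 ℕ.* m) ℕ.* m      ∎))
      (ℕ.^-monoˡ-≤ (2 ℕ.* m) m<n)
    where
    e = m ℕ.^ (2 ℕ.* m)
    open ℕ.≤-Reasoning
    open ℕS.+-*-Solver

  widen : ∀ u v d A B .{{_ : NonZero B}} → P u v d A B →
          ∃[ k ] (NonZero k × P (suc (u ℕ.* k)) (v ℕ.* k) (d ℕ.* k) A B)
  widen u v d A B h = k , ℕ.m*n≢0 2 m , subst₂ ℕ._<_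
      (trans (cong (2 ℕ.*_) (powP u B d k)) (sym (ℕ.*-assoc 2 (2 ℕ.^ (u ℕ.* k)) _)))
      (powP v A d k)
      (double m h)
    where
    m = 2 ℕ.^ u ℕ.* B ℕ.^ d
    instance
      m≢0 : NonZero m
      m≢0 = ℕ.m*n≢0 (2 ℕ.^ u) (B ℕ.^ d) {{ℕ.m^n≢0 2 u}} {{ℕ.m^n≢0 B d}}
    k = 2 ℕ.* m

  scaled : ∀ p n k → (n ℤ.* (p ℤ.* k)) ≡ (n ℤ.* k) ℤ.* p
  scaled = solve 3 (λ p n k → n :* (p :* k) := (n :* k) :* p) refl
    where open ℤS.+-*-Solver

  openₗ : ∀ x q → q <ₗ x → ∃[ r ] (q ℚ.< r × r <ₗ x)
  openₗ x q@(mkℚᵘ z d-1) h with widen (pos z) (neg z) (↧ₙ q) ∣ ↥ x ∣ (↧ₙ x) h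
  ... | k@(suc _) , _ , h′ = frac u v d , *<* lt , P⇒<ₗ x u v d h′
    where
    u = suc (pos z ℕ.* k)
    v = neg z ℕ.* k
    d = suc d-1 ℕ.* k
    open ℤ.≤-Reasoning
    open ℤS.+-*-Solver
    lt : z ℤ.* + d ℤ.< (+ u ℤ.- + v) ℤ.* + suc d-1
    lt = begin-strict
      z ℤ.* + d                                   ≡⟨ cong (z ℤ.*_) (ℤ.pos-* (suc d-1) k) ⟩
      z ℤ.* (+ suc d-1 ℤ.* + k)                   ≡⟨ scaled (+ suc d-1) z (+ k) ⟩
      (z ℤ.* + k) ℤ.* + suc d-1                   <⟨ ℤ.*-monoʳ-<-pos (+ suc d-1) {z ℤ.* + k} {ℤ.suc (z ℤ.* + k)} (ℤ.suc[i]≤j⇒i<j (ℤ.≤-refl {ℤ.suc (z ℤ.* + k)})) ⟩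
      ℤ.suc (z ℤ.* + k) ℤ.* + suc d-1
        ≡⟨ cong (λ t → ℤ.suc (t ℤ.* + k) ℤ.* + suc d-1) (pos-neg z) ⟩
      ℤ.suc ((+ pos z ℤ.- + neg z) ℤ.* + k) ℤ.* + suc d-1
        ≡⟨ cong (ℤ._* + suc d-1) (solve 3 (λ a b k → con (+ 1) :+ (a :- b) :* k
              := (con (+ 1) :+ a :* k) :- b :* k) refl (+ pos z) (+ neg z) (+ k)) ⟩
      ((+ 1 ℤ.+ + pos z ℤ.* + k) ℤ.- + neg z ℤ.* + k) ℤ.* + suc d-1
        ≡⟨ cong₂ (λ a b → ((+ 1 ℤ.+ a) ℤ.- b) ℤ.* + suc d-1)
             (sym (ℤ.pos-* (pos z) k)) (sym (ℤ.pos-* (neg z) k)) ⟩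
      (+ u ℤ.- + v) ℤ.* + suc d-1                 ∎

  openᵤ : ∀ x .{{_ : Positive x}} q → q >ₗ x → ∃[ r ] (r ℚ.< q × r >ₗ x)
  openᵤ x@(mkℚᵘ +[1+ _ ] _) q@(mkℚᵘ z d-1) h with widen (neg z) (pos z) (↧ₙ q) (↧ₙ x) ∣ ↥ x ∣ h
  ... | k@(suc _) , _ , h′ = frac u v d , *<* lt , P⇒>ₗ x u v d h′
    where
    u = pos z ℕ.* k
    v = suc (neg z ℕ.* k)
    d = suc d-1 ℕ.* k
    open ℤ.≤-Reasoning
    open ℤS.+-*-Solver
    lt : (+ u ℤ.- + v) ℤ.* + suc d-1 ℤ.< z ℤ.* + d
    lt = begin-strict
      (+ u ℤ.- + v) ℤ.* + suc d-1
        ≡⟨ cong₂ (λ a b → (a ℤ.- (+ 1 ℤ.+ b)) ℤ.* + suc d-1)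
             (ℤ.pos-* (pos z) k) (ℤ.pos-* (neg z) k) ⟩
      (+ pos z ℤ.* + k ℤ.- (+ 1 ℤ.+ + neg z ℤ.* + k)) ℤ.* + suc d-1
        ≡⟨ cong (ℤ._* + suc d-1) (solve 3 (λ a b k → a :* k :- (con (+ 1) :+ b :* k)
              := con (ℤ.- + 1) :+ (a :- b) :* k) refl (+ pos z) (+ neg z) (+ k)) ⟩
      ℤ.pred ((+ pos z ℤ.- + neg z) ℤ.* + k) ℤ.* + suc d-1
        ≡⟨ cong (λ t → ℤ.pred (t ℤ.* + k) ℤ.* + suc d-1) (sym (pos-neg z)) ⟩
      ℤ.pred (z ℤ.* + k) ℤ.* + suc d-1            <⟨ ℤ.*-monoʳ-<-pos (+ suc d-1) {ℤ.pred (z ℤ.* + k)} {z ℤ.* + k} (ℤ.i≤pred[j]⇒i<j (ℤ.≤-refl {ℤ.pred (z ℤ.* + k)})) ⟩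
      (z ℤ.* + k) ℤ.* + suc d-1                   ≡⟨ sym (scaled (+ suc d-1) z (+ k)) ⟩
      z ℤ.* (+ suc d-1 ℤ.* + k)                   ≡⟨ cong (z ℤ.*_) (sym (ℤ.pos-* (suc d-1) k)) ⟩
      z ℤ.* + d                                   ∎

  ⌊log⌋ : ∀ n .{{_ : NonZero n}} → ∃[ k ] (2 ℕ.^ k ℕ.≤ n × n ℕ.< 2 ℕ.^ suc k)
  ⌊log⌋ 1 = 0 , ℕ.≤-refl , s≤s (s≤s z≤n)
  ⌊log⌋ (suc n@(suc _)) with ⌊log⌋ n
  ... | k , lo , hi with suc n ℕ.<? 2 ℕ.^ suc k
  ...   | yes lt = k , ℕ.≤-trans lo (ℕ.n≤1+n n) , lt
  ...   | no ¬lt = suc k , ℕ.≮⇒≥ ¬lt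
                 , ℕ.≤-<-trans hi (ℕ.^-monoʳ-< 2 (s≤s (s≤s z≤n)) (ℕ.n<1+n (suc k)))

  approx : ∀ x .{{_ : Positive x}} ε → Positive ε → ∃[ q ] (q <ₗ x × (q ℚ.+ ε) >ₗ x)
  approx x@(mkℚᵘ +[1+ a-1 ] b-1) (mkℚᵘ +[1+ e ] f-1) _
    with ⌊log⌋ (suc a-1 ℕ.^ (2 ℕ.* suc f-1)) {{ℕ.m^n≢0 (suc a-1) (2 ℕ.* suc f-1)}}
       | ⌊log⌋ (suc b-1 ℕ.^ (2 ℕ.* suc f-1)) {{ℕ.m^n≢0 (suc b-1) (2 ℕ.* suc f-1)}}
  ... | α , α-lo , α-hi | β , β-lo , β-hi =
        q , P⇒<ₗ x α (suc β) d (ℕ.≤-<-trans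
                (ℕ.*-monoˡ-≤ (suc b-1 ℕ.^ d) α-lo)
                (ℕ.<-≤-trans (ℕ.*-monoʳ-< (suc a-1 ℕ.^ d) {{ℕ.m^n≢0 (suc a-1) d}} β-hi)
                  (ℕ.≤-reflexive (ℕ.*-comm (suc a-1 ℕ.^ d) _))))
          , upper x q′≤q+ε (P⇒>ₗ x (suc α) β d (ℕ.≤-<-trans
                (ℕ.*-monoˡ-≤ (suc a-1 ℕ.^ d) β-lo)
                (ℕ.<-≤-trans (ℕ.*-monoʳ-< (suc b-1 ℕ.^ d) {{ℕ.m^n≢0 (suc b-1) d}} α-hi)
                  (ℕ.≤-reflexive (ℕ.*-comm (suc b-1 ℕ.^ d) _)))))
    where
    d = 2 ℕ.* suc f-1
    q = frac α (suc β) d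
    q′ = frac (suc α) β d
    ε = mkℚᵘ +[1+ e ] f-1
    1/f = mkℚᵘ (+ 1) f-1
    q′≃ : q′ ≃ q ℚ.+ 1/f
    q′≃ = *≡* (trans (cong (λ t → (+ suc α ℤ.- + β) ℤ.* t) (trans (ℤ.pos-* d (suc f-1)) (cong (ℤ._* + suc f-1) (ℤ.pos-* 2 (suc f-1)))))
            (trans (solve 3 (λ a b f → (con (+ 1) :+ a :- b) :* (con (+ 2) :* f :* f)
               := ((a :- (con (+ 1) :+ b)) :* f :+ con (+ 1) :* (con (+ 2) :* f)) :* (con (+ 2) :* f))
               refl (+ α) (+ β) (+ suc f-1))
             (cong (λ t → ((+ α ℤ.- + suc β) ℤ.* + suc f-1 ℤ.+ + 1 ℤ.* t) ℤ.* t) (sym (ℤ.pos-* 2 (suc f-1))))))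
      where open ℤS.+-*-Solver
    q′≤q+ε : q′ ℚ.≤ q ℚ.+ ε
    q′≤q+ε = ℚ.≤-trans (ℚ.≤-reflexive q′≃)
      (ℚ.+-monoʳ-≤ q {1/f} {ε} (*≤* (ℤ.*-monoʳ-≤-nonNeg (+ suc f-1) {+ 1} {+[1+ e ]} (+≤+ (s≤s z≤n)))))

log₂ : ℚ⁺ → ℝ
log₂ record { value = x } = record
  { L = _<ₗ x
  ; U = _>ₗ x
  ; L-closed  = λ {p} {q} → Log.lower x {p} {q}
  ; U-closed  = λ {p} {q} → Log.upper x {p} {q}
  ; L-open    = λ {q} → Log.openₗ x q
  ; U-open    = λ {q} → Log.openᵤ x q
  ; separated = λ {p} {q} → Log.sep x {p} {q}
  ; located   = Log.approx x
  }

module _ {a} {A : Set a} where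

  -- The entropy of a partition of an array of size n into nonempty blocks.
  entropy : (n : ℕ) .{{_ : NonZero n}} → List (List⁺ A) → ℝ
  entropy n Rs = ∑ Rs λ R →
    List⁺.length R / n • log₂ (n / List⁺.length R)

module _ {c ℓ₁ ℓ₂} (O : DecTotalOrder c ℓ₁ ℓ₂) where

  open DecTotalOrder O using (Carrier; _≤?_)

  -- In a total order, y > z amounts to ¬ (y ≤ z).
  _>ᵇ_ : Carrier → Carrier → Bool
  y >ᵇ z = not (does (y ≤? z))

  runs : List Carrier → List (List⁺ Carrier)
  runs []       = []
  runs (x ∷ xs) with runs xs
  ... | []              = (x ∷ []) ∷ []
  ... | (y ∷ ys) ∷ rest = if x >ᵇ y
                          then (x ∷ []) ∷ (y ∷ ys) ∷ rest
                          else (x ∷ y ∷ ys) ∷ rest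

  -- The check A[m-1] > A[m], for ys = A[l..m) and zs = A[m..r).
  unordered : List Carrier → List Carrier → Bool
  unordered ys zs with List.last ys | List.head zs
  ... | just y | just z = y >ᵇ z
  ... | _      | _      = false

  take-shrinks : ∀ (xs : List Carrier) → 2 ℕ.≤ length xs →
                 length (take ⌊ length xs /2⌋ xs) ℕ.< length xs
  take-shrinks (_ ∷ []) (s≤s ())
  take-shrinks xs@(_ ∷ _ ∷ _) _ = ℕ.≤-<-trans
    (ℕ.≤-trans (ℕ.≤-reflexive (List.length-take ⌊ length xs /2⌋ xs)) (ℕ.m⊓n≤m _ _))
    (ℕ.⌊n/2⌋<n _)

  drop-shrinks : ∀ (xs : List Carrier) → 2 ℕ.≤ length xs →
                 length (drop ⌊ length xs /2⌋ xs) ℕ.< length xs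
  drop-shrinks (_ ∷ []) (s≤s ())
  drop-shrinks (_ ∷ x ∷ xs) _ = s≤s (ℕ.≤-trans
    (ℕ.≤-reflexive (List.length-drop ⌊ length xs /2⌋ (x ∷ xs)))
    (ℕ.m∸n≤m (length (x ∷ xs)) ⌊ length xs /2⌋))

  -- The recursive calls act on disjoint subarrays, so the in-place procedure on
  -- A[l..r) is a function of the contents of A[l..r); it returns the new
  -- contents together with the mergecost of the call.
  mergesort-acc : (xs : List Carrier) → Acc ℕ._<_ (length xs) → List Carrier × ℕ
  mergesort-acc xs (acc rec) with 2 ℕ.≤? length xs
  ... | no  _   = xs , 0
  ... | yes 2≤s =
    let s       = length xs
        m       = ⌊ s /2⌋
        ys , M₁ = mergesort-acc (take m xs) (rec (take-shrinks xs 2≤s))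
        zs , M₂ = mergesort-acc (drop m xs) (rec (drop-shrinks xs 2≤s))
    in if unordered ys zs
       then (merge _≤?_ ys zs , M₁ ℕ.+ M₂ ℕ.+ s)
       else (ys ++ zs         , M₁ ℕ.+ M₂)

  mergesort : List Carrier → List Carrier × ℕ
  mergesort xs = mergesort-acc xs (<-wellFounded (length xs))

  mergecost : List Carrier → ℕ
  mergecost xs = proj₂ (mergesort xs)

-- A node of the recursion tree whose entries lie in one run is never merged, so the
-- mergecost is at most the sum, over runs R and nodes v not contained in R, of |v ∩ R|.
-- On a given level at most two nodes meet R = R_i without being contained in it, and such a
-- node of size at most ⌈n/2^d⌉ meets R in at most ⌈n/2^d⌉ - 1 < n/2^d entries.  Hence R pays
-- at most ∑_d min(L_i, 2n/2^d).  Writing n/L_i = 2^(k+f) with 0 ≤ f < 1, the first k+2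
-- levels contribute at most (k+2) L_i and the others at most n/2^k = 2^f L_i; since
-- 2^f ≤ 1+f, this is at most L_i (log₂(n/L_i) + 3).

module Submission where

-- Integer inequalities, and the sum over recursion levels that bounds the cost of one run.

module Arithmetic where

  open import Data.Nat.Base
  open import Data.Nat.DivMod using (m≡m%n+[m/n]*n; m%n<n)
  open import Data.Nat.Properties
  open import Data.Nat.Solver using (module +-*-Solver)
  open import Data.Sum.Base using (inj₁; inj₂)
  open import Defs using (module Log)
  open import Relation.Binary.PropositionalEquality using (_≡_; refl; sym; trans; cong)
  open +-*-Solver
  open ≤-Reasoning

  2ab≤a²+b² : ∀ a b → 2 * (a * b) ≤ a * a + b * b
  2ab≤a²+b² a b with ≤-total a b
  ... | inj₁ a≤b with d ← b ∸ a | refl ← sym (m+[n∸m]≡n a≤b) =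
    m+n≤o⇒m≤o _ (≤-reflexive (solve 2 (λ a d → con 2 :* (a :* (a :+ d)) :+ d :* d
                                := a :* a :+ (a :+ d) :* (a :+ d)) refl a d))
  ... | inj₂ b≤a with d ← a ∸ b | refl ← sym (m+[n∸m]≡n b≤a) =
    m+n≤o⇒m≤o _ (≤-reflexive (solve 2 (λ b d → con 2 :* ((b :+ d) :* b) :+ d :* d
                                := (b :+ d) :* (b :+ d) :+ b :* b) refl b d))

  -- Weighted AM-GM for k copies of `a ^ suc k` and one of `b ^ suc k`. Induction: multiply
  -- `2ab ≤ a² + b²` by `suc k * a ^ k`, apply the hypothesis times b, and cancel the surplus
  -- `k * a ^ suc k * b`.
  young : ∀ k a b → suc k * (a ^ k * b) ≤ k * a ^ suc k + b ^ suc k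
  young zero    a b = ≤-reflexive (solve 1 (λ b → con 1 :* (con 1 :* b) := b :* con 1) refl b)
  young (suc k) a b = +-cancelʳ-≤ (k * a * c * b) _ _ (begin
    suc (suc k) * (a * c * b) + k * a * c * b
      ≡⟨ solve 4 (λ k a b c → (con 2 :+ k) :* (a :* c :* b) :+ k :* a :* c :* b
                              := (con 1 :+ k) :* c :* (con 2 :* (a :* b))) refl k a b c ⟩
    suc k * c * (2 * (a * b))
      ≤⟨ *-monoʳ-≤ (suc k * c) (2ab≤a²+b² a b) ⟩
    suc k * c * (a * a + b * b)
      ≡⟨ solve 4 (λ k a b c → (con 1 :+ k) :* c :* (a :* a :+ b :* b)
                              := (con 1 :+ k) :* (a :* (a :* c)) :+ b :* ((con 1 :+ k) :* (c :* b)))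
               refl k a b c ⟩
    suc k * (a * (a * c)) + b * (suc k * (c * b))
      ≤⟨ +-monoʳ-≤ (suc k * (a * (a * c))) (*-monoʳ-≤ b (young k a b)) ⟩
    suc k * (a * (a * c)) + b * (k * (a * c) + b * d)
      ≡⟨ solve 5 (λ k a b c d → (con 1 :+ k) :* (a :* (a :* c)) :+ b :* (k :* (a :* c) :+ b :* d)
                  := (con 1 :+ k) :* (a :* (a :* c)) :+ b :* (b :* d) :+ k :* a :* c :* b)
               refl k a b c d ⟩
    suc k * (a * (a * c)) + b * (b * d) + k * a * c * b ∎)
    where c = a ^ k
          d = b ^ k

  -- (S/e)^e x ≤ ((S+x)/(e+1))^(e+1): Young's inequality at a = S(e+1), b = e(S+x).
  mean-step : ∀ e S x → S ^ e * suc e ^ suc e * x ≤ e ^ e * (S + x) ^ suc e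
  -- Separate because the general case cancels a factor `e`.
  mean-step zero    S x = begin
    1 * x             ≡⟨ *-identityˡ x ⟩
    x                 ≤⟨ m≤n+m x S ⟩
    S + x             ≡⟨ solve 1 (λ y → y := con 1 :* (y :* con 1)) refl (S + x) ⟩
    1 * (S + x) ^ 1   ∎
  mean-step e@(suc _) S x = *-cancelˡ-≤ e (+-cancelʳ-≤ (e * a * a ^ e) _ _ (begin
    e * (S ^ e * suc e ^ suc e * x) + e * a * a ^ e
      ≡⟨ cong (λ z → e * (S ^ e * suc e ^ suc e * x) + e * a * z) (Log.^-distribʳ-* S (suc e) e) ⟩
    e * (S ^ e * suc e ^ suc e * x) + e * a * (S ^ e * suc e ^ e)
      ≡⟨ solve 5 (λ e S x s t → e :* (s :* ((con 1 :+ e) :* t) :* x)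
                                  :+ e :* (S :* (con 1 :+ e)) :* (s :* t)
                    := (con 1 :+ e) :* ((s :* t) :* (e :* (S :+ x))))
               refl e S x (S ^ e) (suc e ^ e) ⟩
    suc e * (S ^ e * suc e ^ e * b)
      ≡⟨ cong (λ z → suc e * (z * b)) (sym (Log.^-distribʳ-* S (suc e) e)) ⟩
    suc e * (a ^ e * b)
      ≤⟨ young e a b ⟩
    e * (a * a ^ e) + b ^ suc e
      ≡⟨ cong (e * (a * a ^ e) +_) (Log.^-distribʳ-* e (S + x) (suc e)) ⟩
    e * (a * a ^ e) + e * e ^ e * (S + x) ^ suc e
      ≡⟨ solve 5 (λ e a c f g → e :* (a :* c) :+ e :* f :* g := e :* (f :* g) :+ e :* a :* c)
               refl e a (a ^ e) (e ^ e) ((S + x) ^ suc e) ⟩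
    e * (e ^ e * (S + x) ^ suc e) + e * a * a ^ e ∎))
    where a = S * suc e
          b = e * (S + x)

  -- Holds at 0 too, where the power is 1; the AM-GM induction that follows cancels `e ^ e` even for
  -- `e = 0`.
  n^n≢0 : ∀ n → NonZero (n ^ n)
  n^n≢0 zero      = _
  n^n≢0 n@(suc _) = m^n≢0 n n

  -- 2^x ≤ 1 + x for x = g/e ∈ [0,1]; AM-GM for g copies of 2 and e - g copies of 1.
  2^g*e^e≤[e+g]^e : ∀ g e → g ≤ e → 2 ^ g * e ^ e ≤ (e + g) ^ e
  2^g*e^e≤[e+g]^e zero    e       _         = ≤-reflexive
    (trans (*-identityˡ (e ^ e)) (cong (_^ e) (sym (+-identityʳ e))))
  2^g*e^e≤[e+g]^e (suc g) (suc e) (s≤s g≤e) = *-cancelˡ-≤ (e ^ e) {{n^n≢0 e}} (begin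
    e ^ e * (2 ^ suc g * suc e ^ suc e)
      ≡⟨ solve 3 (λ c p d → c :* (con 2 :* p :* d) := p :* c :* d :* con 2)
               refl (e ^ e) (2 ^ g) (suc e ^ suc e) ⟩
    2 ^ g * e ^ e * suc e ^ suc e * 2
      ≤⟨ *-monoˡ-≤ 2 (*-monoˡ-≤ (suc e ^ suc e) (2^g*e^e≤[e+g]^e g e g≤e)) ⟩
    (e + g) ^ e * suc e ^ suc e * 2
      -- The e numbers used so far, g of them equal to 2 and the others to 1, have sum e + g; one
      -- more 2 is adjoined.
      ≤⟨ mean-step e (e + g) 2 ⟩
    e ^ e * (e + g + 2) ^ suc e
      ≡⟨ cong (λ z → e ^ e * z ^ suc e)
           (solve 2 (λ e g → e :+ g :+ con 2 := con 1 :+ e :+ (con 1 :+ g)) refl e g) ⟩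
    e ^ e * (suc e + suc g) ^ suc e ∎)

  -- The cost of a block of ℓ entries in a node of size at most t + 1 that lies on h
  -- levels of recursion, where j is the number of ends of the block that are interior
  -- to the node.  On every level at most j subnodes meet the block without being
  -- contained in it, and each of those meets it in at most t′ entries, where t′ + 1
  -- bounds the sizes of that level; t′ is exactly halved from one level to the next.
  blockCost : (h j ℓ t : ℕ) → ℕ
  blockCost zero    j ℓ t = 0
  blockCost (suc h) j ℓ t = ℓ ⊓ (j * t) + blockCost h j ℓ ⌊ t /2⌋

  blockCost-monoˡ : ∀ h {i j} ℓ t → i ≤ j → blockCost h i ℓ t ≤ blockCost h j ℓ t
  blockCost-monoˡ zero    ℓ t i≤j = z≤n
  blockCost-monoˡ (suc h) ℓ t i≤j =
    +-mono-≤ (⊓-mono-≤ (≤-refl {ℓ}) (*-monoˡ-≤ t i≤j)) (blockCost-monoˡ h ℓ ⌊ t /2⌋ i≤j)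

  -- On each level the two minima add up to at most a + b and at most (i + j)t. This handles a run
  -- that is cut by a midpoint into two blocks.
  blockCost-superadditive : ∀ h i j a b t →
    blockCost h i a t + blockCost h j b t ≤ blockCost h (i + j) (a + b) t
  blockCost-superadditive zero    i j a b t = z≤n
  blockCost-superadditive (suc h) i j a b t = begin
    (a ⊓ (i * t) + A) + (b ⊓ (j * t) + B)
      ≡⟨ solve 4 (λ x A y B → (x :+ A) :+ (y :+ B) := (x :+ y) :+ (A :+ B))
               refl (a ⊓ (i * t)) A (b ⊓ (j * t)) B ⟩
    (a ⊓ (i * t) + b ⊓ (j * t)) + (A + B)
      ≤⟨ +-mono-≤ (⊓-glb (+-mono-≤ (m⊓n≤m a (i * t)) (m⊓n≤m b (j * t)))
                         (≤-trans (+-mono-≤ (m⊓n≤n a (i * t)) (m⊓n≤n b (j * t)))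
                                  (≤-reflexive (sym (*-distribʳ-+ t i j)))))
                  (blockCost-superadditive h i j a b ⌊ t /2⌋) ⟩
    (a + b) ⊓ ((i + j) * t) + blockCost h (i + j) (a + b) ⌊ t /2⌋ ∎
    where A = blockCost h i a ⌊ t /2⌋
          B = blockCost h j b ⌊ t /2⌋

  -- A block that has an interior end and fits into t pays its full length for the level.
  blockCost-level : ∀ h j {ℓ t} → ℓ ≤ t →
    blockCost (suc h) (suc j) ℓ t ≡ ℓ + blockCost h (suc j) ℓ ⌊ t /2⌋
  blockCost-level h j {ℓ} {t} ℓ≤t =
    cong (_+ blockCost h (suc j) ℓ ⌊ t /2⌋) (m≤n⇒m⊓n≡m (≤-trans ℓ≤t (m≤m+n t (j * t))))

  2*⌊n/2⌋≤n : ∀ n → 2 * ⌊ n /2⌋ ≤ n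
  2*⌊n/2⌋≤n n = begin
    2 * ⌊ n /2⌋         ≡⟨ cong (⌊ n /2⌋ +_) (+-identityʳ ⌊ n /2⌋) ⟩
    ⌊ n /2⌋ + ⌊ n /2⌋   ≤⟨ +-monoʳ-≤ ⌊ n /2⌋ (⌊n/2⌋-mono (n≤1+n n)) ⟩
    ⌊ n /2⌋ + ⌈ n /2⌉   ≡⟨ ⌊n/2⌋+⌈n/2⌉≡n n ⟩
    n                   ∎

  4*⌊n/2⌋≤2*n : ∀ n → 4 * ⌊ n /2⌋ ≤ 2 * n
  4*⌊n/2⌋≤2*n n = begin
    4 * ⌊ n /2⌋       ≡⟨ *-assoc 2 2 ⌊ n /2⌋ ⟩
    2 * (2 * ⌊ n /2⌋) ≤⟨ *-monoʳ-≤ 2 (2*⌊n/2⌋≤n n) ⟩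
    2 * n             ∎

  -- Geometric series 2t + t + t/2 + ..., taking the second argument of every minimum.
  blockCost≤4*t : ∀ h ℓ t → blockCost h 2 ℓ t ≤ 4 * t
  blockCost≤4*t zero    ℓ t = z≤n
  blockCost≤4*t (suc h) ℓ t = begin
    ℓ ⊓ (2 * t) + blockCost h 2 ℓ ⌊ t /2⌋
      ≤⟨ +-mono-≤ (m⊓n≤n ℓ (2 * t)) (blockCost≤4*t h ℓ ⌊ t /2⌋) ⟩
    2 * t + 4 * ⌊ t /2⌋   ≤⟨ +-monoʳ-≤ (2 * t) (4*⌊n/2⌋≤2*n t) ⟩
    2 * t + 2 * t         ≡⟨ sym (*-distribʳ-+ t 2 2) ⟩
    4 * t                 ∎

  -- The first k levels pay at most ℓ each and the remaining ones at most 4t / 2^k in total;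
  -- everything is multiplied by 2^k to stay in the integers.
  blockCost-split : ∀ k h ℓ t → 2 ^ k * blockCost h 2 ℓ t ≤ 2 ^ k * (k * ℓ) + 4 * t
  blockCost-split zero    h       ℓ t = ≤-trans (≤-reflexive (*-identityˡ _)) (blockCost≤4*t h ℓ t)
  blockCost-split (suc k) zero    ℓ t = ≤-trans (≤-reflexive (*-zeroʳ (2 ^ suc k))) z≤n
  blockCost-split (suc k) (suc h) ℓ t = begin
    2 * c * (ℓ ⊓ (2 * t) + B)
      ≤⟨ *-monoʳ-≤ (2 * c) (+-monoˡ-≤ B (m⊓n≤m ℓ (2 * t))) ⟩
    2 * c * (ℓ + B)
      ≡⟨ solve 3 (λ c ℓ B → con 2 :* c :* (ℓ :+ B) := con 2 :* c :* ℓ :+ con 2 :* (c :* B))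
               refl c ℓ B ⟩
    2 * c * ℓ + 2 * (c * B)
      ≤⟨ +-monoʳ-≤ (2 * c * ℓ) (*-monoʳ-≤ 2 (blockCost-split k h ℓ ⌊ t /2⌋)) ⟩
    2 * c * ℓ + 2 * (c * (k * ℓ) + 4 * ⌊ t /2⌋)
      ≡⟨ solve 4 (λ c k ℓ s → con 2 :* c :* ℓ :+ con 2 :* (c :* (k :* ℓ) :+ con 4 :* s)
                    := con 2 :* c :* ((con 1 :+ k) :* ℓ) :+ con 4 :* (con 2 :* s))
               refl c k ℓ ⌊ t /2⌋ ⟩
    2 * c * (suc k * ℓ) + 4 * (2 * ⌊ t /2⌋)
      ≤⟨ +-monoʳ-≤ (2 * c * (suc k * ℓ)) (*-monoʳ-≤ 4 (2*⌊n/2⌋≤n t)) ⟩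
    2 * c * (suc k * ℓ) + 4 * t ∎
    where c = 2 ^ k
          B = blockCost h 2 ℓ ⌊ t /2⌋

  -- For n/ℓ < 2^(p/e), write p/e = k + g/e with g < e; then n/ℓ < 2^k (1 + g/e).
  blockCost≤log : ∀ e p {h ℓ n t} .{{_ : NonZero e}} → t ≤ n → n ^ e < 2 ^ p * ℓ ^ e →
    e * blockCost h 2 ℓ t ≤ ℓ * (p + 3 * e)
  blockCost≤log e p {h} {ℓ} {n} {t} t≤n n^e<2^p*ℓ^e = *-cancelˡ-≤ (4 * c) (begin
    4 * c * (e * B)
      ≡⟨ solve 3 (λ c e B → con 4 :* c :* (e :* B) := e :* (con 2 :* (con 2 :* c) :* B)) refl c e B ⟩
    e * (2 ^ (2 + k) * B)
      -- With k + 2 full levels the tail is 4t / 2^(k+2), hence at most n / 2^k.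
      ≤⟨ *-monoʳ-≤ e (blockCost-split (2 + k) h ℓ t) ⟩
    e * (2 ^ (2 + k) * ((2 + k) * ℓ) + 4 * t)
      ≤⟨ *-monoʳ-≤ e (+-monoʳ-≤ (2 ^ (2 + k) * ((2 + k) * ℓ)) (*-monoʳ-≤ 4 t≤n)) ⟩
    e * (2 ^ (2 + k) * ((2 + k) * ℓ) + 4 * n)
      ≡⟨ solve 5 (λ e c k ℓ n → e :* (con 2 :* (con 2 :* c) :* ((con 2 :+ k) :* ℓ) :+ con 4 :* n)
                    := con 4 :* (e :* (c :* ((con 2 :+ k) :* ℓ))) :+ con 4 :* (e :* n))
               refl e c k ℓ n ⟩
    4 * (e * (c * ((2 + k) * ℓ))) + 4 * (e * n)
      ≤⟨ +-monoʳ-≤ (4 * (e * (c * ((2 + k) * ℓ)))) (*-monoʳ-≤ 4 (<⇒≤ e*n<c*ℓ*[e+g])) ⟩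
    4 * (e * (c * ((2 + k) * ℓ))) + 4 * (c * ℓ * (e + g))
      ≡⟨ solve 5 (λ e c k ℓ g → con 4 :* (e :* (c :* ((con 2 :+ k) :* ℓ))) :+ con 4 :* (c :* ℓ :* (e :+ g))
                    := con 4 :* c :* (ℓ :* ((g :+ k :* e) :+ con 3 :* e)))
               refl e c k ℓ g ⟩
    4 * c * (ℓ * (g + k * e + 3 * e))
      ≡⟨ cong (λ z → 4 * c * (ℓ * (z + 3 * e))) (sym p≡g+k*e) ⟩
    4 * c * (ℓ * (p + 3 * e)) ∎)
    where
    k = p / e
    g = p % e
    c = 2 ^ k
    B = blockCost h 2 ℓ t
    instance
      c≢0 : NonZero c
      c≢0 = m^n≢0 2 k
      4c≢0 : NonZero (4 * c)
      4c≢0 = m*n≢0 4 c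
      e^e≢0 : NonZero (e ^ e)
      e^e≢0 = n^n≢0 e
    p≡g+k*e : p ≡ g + k * e
    p≡g+k*e = m≡m%n+[m/n]*n p e
    e*n<c*ℓ*[e+g] : e * n < c * ℓ * (e + g)
    -- This is n / 2^k < ℓ (1 + g/e), obtained by comparing e-th powers.
    e*n<c*ℓ*[e+g] = Log.unpow-< e (begin-strict
      (e * n) ^ e                         ≡⟨ Log.^-distribʳ-* e n e ⟩
      e ^ e * n ^ e                       <⟨ *-monoʳ-< (e ^ e) n^e<2^p*ℓ^e ⟩
      e ^ e * (2 ^ p * ℓ ^ e)             ≡⟨ cong (λ z → e ^ e * (2 ^ z * ℓ ^ e)) p≡g+k*e ⟩
      e ^ e * (2 ^ (g + k * e) * ℓ ^ e)
        ≡⟨ cong (λ z → e ^ e * (z * ℓ ^ e))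
             (trans (^-distribˡ-+-* 2 g (k * e)) (cong (2 ^ g *_) (sym (^-*-assoc 2 k e)))) ⟩
      e ^ e * (2 ^ g * c ^ e * ℓ ^ e)
        ≡⟨ solve 4 (λ a b c d → a :* (b :* c :* d) := c :* d :* (b :* a))
                 refl (e ^ e) (2 ^ g) (c ^ e) (ℓ ^ e) ⟩
      c ^ e * ℓ ^ e * (2 ^ g * e ^ e)
        ≤⟨ *-monoʳ-≤ (c ^ e * ℓ ^ e) (2^g*e^e≤[e+g]^e g e (<⇒≤ (m%n<n p e))) ⟩
      c ^ e * ℓ ^ e * (e + g) ^ e
        ≡⟨ cong (_* (e + g) ^ e) (sym (Log.^-distribʳ-* c ℓ e)) ⟩
      (c * ℓ) ^ e * (e + g) ^ e           ≡⟨ sym (Log.^-distribʳ-* (c * ℓ) (e + g) e) ⟩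
      (c * ℓ * (e + g)) ^ e               ∎)

-- The merge cost of a recursion node, shared among its blocks of runs.

module Counting where

  open import Data.Bool.Base using (Bool; true; false; if_then_else_)
  open import Data.List.Base using (List; []; _∷_; _++_; length; map; take; drop)
  open import Data.List.NonEmpty.Base as List⁺ using (_∷_)
  open import Data.List.Properties using (length-take; length-drop; take++drop≡id)
  open import Data.List.Relation.Unary.All using (All; []; _∷_)
  open import Data.Nat.Base
  open import Data.Nat.Induction using (Acc; acc; <-wellFounded)
  open import Data.Nat.ListAction using (sum)
  open import Data.Nat.Properties
  open import Data.Nat.Solver using (module +-*-Solver)
  open import Data.Product.Base using (_×_; _,_; ∃-syntax; proj₁; proj₂)
  open import Defs using (runs; mergesort-acc; mergecost; unordered; _>ᵇ_; take-shrinks; drop-shrinks)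
  open import Relation.Binary.Bundles using (DecTotalOrder)
  open import Relation.Binary.PropositionalEquality using (_≡_; refl; sym; trans; cong; cong₂; subst)
  open import Relation.Nullary using (yes; no; contradiction)
  open Arithmetic
  open +-*-Solver
  open ≤-Reasoning

  -- i and j tell whether the left end of the first block and the right end of the last
  -- one are interior to the node; all other ends are.
  nodeCost : (i j h t : ℕ) → List ℕ → ℕ
  nodeCost i j h t []           = 0
  nodeCost i j h t (p ∷ [])     = blockCost h (i + j) p t
  nodeCost i j h t (p ∷ q ∷ ps) = blockCost h (i + 1) p t + nodeCost 1 j h t (q ∷ ps)

  nodeCost-monoˡ : ∀ j h t ps → nodeCost 0 j h t ps ≤ nodeCost 1 j h t ps
  nodeCost-monoˡ j h t []           = z≤n
  nodeCost-monoˡ j h t (p ∷ [])     = blockCost-monoˡ h p t (n≤1+n j)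
  nodeCost-monoˡ j h t (p ∷ q ∷ ps) = +-monoˡ-≤ _ (blockCost-monoˡ h p t (n≤1+n 1))

  nodeCost≤∑ : ∀ h t ps → nodeCost 0 0 h t ps ≤ sum (map (λ p → blockCost h 2 p t) ps)
  nodeCost≤∑ h t ps = ≤-trans (nodeCost-monoˡ 0 h t ps) (go ps)
    where
    go : ∀ ps → nodeCost 1 0 h t ps ≤ sum (map (λ p → blockCost h 2 p t) ps)
    go []           = z≤n
    go (p ∷ [])     = ≤-trans (blockCost-monoˡ h p t (n≤1+n 1)) (m≤m+n _ 0)
    go (p ∷ q ∷ ps) = +-monoʳ-≤ (blockCost h 2 p t) (go (q ∷ ps))

  -- Every block here has an interior left end and length at most t, so each minimum on the top
  -- level equals the block length.
  sum+nodeCost≡ : ∀ h {t} ps → sum ps ≤ t →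
    sum ps + nodeCost 1 0 h ⌊ t /2⌋ ps ≡ nodeCost 1 0 (suc h) t ps
  sum+nodeCost≡ h     []           _  = refl
  sum+nodeCost≡ h {t} (p ∷ [])     le =
    trans (cong (_+ blockCost h 1 p ⌊ t /2⌋) (+-identityʳ p))
          (sym (blockCost-level h 0 (m+n≤o⇒m≤o p le)))
  sum+nodeCost≡ h {t} (p ∷ q ∷ ps) le = begin-equality
    p + sum (q ∷ ps) + (blockCost h 2 p ⌊ t /2⌋ + nodeCost 1 0 h ⌊ t /2⌋ (q ∷ ps))
      ≡⟨ solve 4 (λ a b c d → a :+ b :+ (c :+ d) := (a :+ c) :+ (b :+ d))
               refl p (sum (q ∷ ps)) (blockCost h 2 p ⌊ t /2⌋) (nodeCost 1 0 h ⌊ t /2⌋ (q ∷ ps)) ⟩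
    (p + blockCost h 2 p ⌊ t /2⌋) + (sum (q ∷ ps) + nodeCost 1 0 h ⌊ t /2⌋ (q ∷ ps))
      ≡⟨ cong₂ _+_ (sym (blockCost-level h 1 (m+n≤o⇒m≤o p le)))
                   (sum+nodeCost≡ h (q ∷ ps) (m+n≤o⇒n≤o p le)) ⟩
    blockCost (suc h) 2 p t + nodeCost 1 0 (suc h) t (q ∷ ps) ∎

  -- A node of size at most t + 1 with two nonempty blocks leaves at most t entries to each of them;
  -- the first block has its right end interior.
  sum+nodeCost≤ : ∀ h {t} p q ps → All (1 ≤_) (p ∷ q ∷ ps) → sum (p ∷ q ∷ ps) ≤ suc t →
    sum (p ∷ q ∷ ps) + nodeCost 0 0 h ⌊ t /2⌋ (p ∷ q ∷ ps) ≤ nodeCost 0 0 (suc h) t (p ∷ q ∷ ps)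
  sum+nodeCost≤ h {t} p q ps (1≤p ∷ 1≤q ∷ _) le = begin
    p + sum (q ∷ ps) + (blockCost h 1 p ⌊ t /2⌋ + nodeCost 1 0 h ⌊ t /2⌋ (q ∷ ps))
      ≡⟨ solve 4 (λ a b c d → a :+ b :+ (c :+ d) := (a :+ c) :+ (b :+ d))
               refl p (sum (q ∷ ps)) (blockCost h 1 p ⌊ t /2⌋) (nodeCost 1 0 h ⌊ t /2⌋ (q ∷ ps)) ⟩
    (p + blockCost h 1 p ⌊ t /2⌋) + (sum (q ∷ ps) + nodeCost 1 0 h ⌊ t /2⌋ (q ∷ ps))
      ≡⟨ cong₂ _+_ (sym (blockCost-level h 0 p≤t)) (sum+nodeCost≡ h (q ∷ ps) rest≤t) ⟩
    blockCost (suc h) 1 p t + nodeCost 1 0 (suc h) t (q ∷ ps) ∎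
    where
    rest≤t : sum (q ∷ ps) ≤ t
    rest≤t = s≤s⁻¹ (≤-trans (+-monoˡ-≤ (sum (q ∷ ps)) 1≤p) le)
    p≤t : p ≤ t
    p≤t = s≤s⁻¹ (begin
      suc p              ≡⟨ +-comm 1 p ⟩
      p + 1              ≤⟨ +-monoʳ-≤ p (≤-trans 1≤q (m≤m+n q (sum ps))) ⟩
      p + sum (q ∷ ps)   ≤⟨ le ⟩
      suc t              ∎)

  -- How the run lengths of a concatenation arise from those of its parts; the flag tells
  -- whether there is a descent at the junction.
  data Join : List ℕ → List ℕ → Bool → List ℕ → Set where
    cut  : ∀ {a b bs} → Join (a ∷ []) (b ∷ bs) true (a ∷ b ∷ bs)
    glue : ∀ {a b bs} → Join (a ∷ []) (b ∷ bs) false (a + b ∷ bs)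
    cons : ∀ {a a′ as bs d c cs} → Join (a′ ∷ as) bs d (c ∷ cs) →
           Join (a ∷ a′ ∷ as) bs d (a ∷ c ∷ cs)

  -- Ends at the junction count as 0 in the halves. At a cut they become interior in the parent,
  -- which only raises its cost; at a glued junction the merged block keeps the outer ends of its
  -- two parts and superadditivity applies.
  nodeCost-join : ∀ {as bs d cs} i j h t → Join as bs d cs →
    nodeCost i 0 h t as + nodeCost 0 j h t bs ≤ nodeCost i j h t cs
  nodeCost-join i j h t (cut {a} {b} {bs}) =
    +-mono-≤ (blockCost-monoˡ h a t (+-monoʳ-≤ i z≤n)) (nodeCost-monoˡ j h t (b ∷ bs))
  nodeCost-join i j h t (glue {a} {b} {[]}) = begin
    blockCost h (i + 0) a t + blockCost h j b t
      ≤⟨ blockCost-superadditive h (i + 0) j a b t ⟩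
    blockCost h (i + 0 + j) (a + b) t
      ≡⟨ cong (λ z → blockCost h (z + j) (a + b) t) (+-identityʳ i) ⟩
    blockCost h (i + j) (a + b) t ∎
  nodeCost-join i j h t (glue {a} {b} {c ∷ bs}) = begin
    blockCost h (i + 0) a t + (blockCost h 1 b t + nodeCost 1 j h t (c ∷ bs))
      ≡⟨ sym (+-assoc (blockCost h (i + 0) a t) _ _) ⟩
    blockCost h (i + 0) a t + blockCost h 1 b t + nodeCost 1 j h t (c ∷ bs)
      ≤⟨ +-monoˡ-≤ _ (blockCost-superadditive h (i + 0) 1 a b t) ⟩
    blockCost h (i + 0 + 1) (a + b) t + nodeCost 1 j h t (c ∷ bs)
      ≡⟨ cong (λ z → blockCost h (z + 1) (a + b) t + nodeCost 1 j h t (c ∷ bs)) (+-identityʳ i) ⟩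
    blockCost h (i + 1) (a + b) t + nodeCost 1 j h t (c ∷ bs) ∎
  nodeCost-join i j h t (cons {a} {a′} {as} {bs} {c = c} {cs} J) = begin
    blockCost h (i + 1) a t + nodeCost 1 0 h t (a′ ∷ as) + nodeCost 0 j h t bs
      ≡⟨ +-assoc (blockCost h (i + 1) a t) _ _ ⟩
    blockCost h (i + 1) a t + (nodeCost 1 0 h t (a′ ∷ as) + nodeCost 0 j h t bs)
      ≤⟨ +-monoʳ-≤ (blockCost h (i + 1) a t) (nodeCost-join 1 j h t J) ⟩
    blockCost h (i + 1) a t + nodeCost 1 j h t (c ∷ cs) ∎

  -- Effect on the run lengths of prepending an entry that extends the first run.
  incrementHead : List ℕ → List ℕ
  incrementHead []       = []
  incrementHead (p ∷ ps) = suc p ∷ ps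

  incrementHead-join : ∀ {as bs d cs} → Join as bs d cs →
    Join (incrementHead as) bs d (incrementHead cs)
  incrementHead-join cut      = cut
  incrementHead-join glue     = glue
  incrementHead-join (cons J) = cons J

  join-singleton : ∀ {as bs d p} → Join as bs d (p ∷ []) →
    ∃[ a ] ∃[ b ] (as ≡ a ∷ [] × bs ≡ b ∷ [] × d ≡ false)
  join-singleton glue = _ , _ , refl , refl , refl

  -- Run lengths of lists and their behaviour under concatenation and halving.

  module _ {c ℓ₁ ℓ₂} (O : DecTotalOrder c ℓ₁ ℓ₂) where

    open DecTotalOrder O using (Carrier)

    runLengths : List Carrier → List ℕ
    runLengths xs = map List⁺.length (runs O xs)

    runLengths-positive : ∀ xs → All (1 ≤_) (runLengths xs)
    runLengths-positive xs = go (runs O xs)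
      where
      go : ∀ Rs → All (1 ≤_) (map (List⁺.length {A = Carrier}) Rs)
      go []       = []
      go (_ ∷ Rs) = s≤s z≤n ∷ go Rs

    -- `runs` compares a new entry with the first entry of the first run; this identifies the latter
    -- as the next entry of the list.
    runs-head : ∀ x xs → ∃[ ys ] ∃[ Rs ] runs O (x ∷ xs) ≡ (x ∷ ys) ∷ Rs
    runs-head x xs with runs O xs
    ... | []            = [] , [] , refl
    ... | (y ∷ ys) ∷ Rs with _>ᵇ_ O x y
    ...   | true  = [] , (y ∷ ys) ∷ Rs , refl
    ...   | false = y ∷ ys , Rs , refl

    runLengths-∷ : ∀ x y ys → runLengths (x ∷ y ∷ ys) ≡
      (if _>ᵇ_ O x y then 1 ∷ runLengths (y ∷ ys) else incrementHead (runLengths (y ∷ ys)))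
    runLengths-∷ x y ys with runs O (y ∷ ys) | runs-head y ys
    ... | _ | zs , Rs , refl with _>ᵇ_ O x y
    ...   | true  = refl
    ...   | false = refl

    runLengths-nonempty : ∀ x xs → ∃[ p ] ∃[ ps ] runLengths (x ∷ xs) ≡ p ∷ ps
    runLengths-nonempty x xs with runs O (x ∷ xs) | runs-head x xs
    ... | _ | zs , Rs , refl = _ , _ , refl

    sum-runLengths : ∀ xs → sum (runLengths xs) ≡ length xs
    sum-runLengths []           = refl
    sum-runLengths (x ∷ [])     = refl
    sum-runLengths (x ∷ y ∷ ys)
      with ih ← sum-runLengths (y ∷ ys)
      rewrite runLengths-∷ x y ys
      with _>ᵇ_ O x y | runLengths (y ∷ ys) | runLengths-nonempty y ys
    ... | true  | _ | _           = cong suc ih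
    ... | false | _ | _ , _ , refl = cong suc ih

    -- Prepending to the left part leaves the junction untouched: it either extends the first run or
    -- starts a new one.
    runLengths-++ : ∀ y ys z zs →
      Join (runLengths (y ∷ ys)) (runLengths (z ∷ zs)) (unordered O (y ∷ ys) (z ∷ zs))
           (runLengths (y ∷ ys ++ z ∷ zs))
    runLengths-++ y [] z zs
      rewrite runLengths-∷ y z zs
      with _>ᵇ_ O y z | runLengths (z ∷ zs) | runLengths-nonempty z zs
    ... | true  | _ | _ , _ , refl = cut
    ... | false | _ | _ , _ , refl = glue
    runLengths-++ x (y ∷ ys) z zs
      with J ← runLengths-++ y ys z zs
      rewrite runLengths-∷ x y ys | runLengths-∷ x y (ys ++ z ∷ zs)
      with _>ᵇ_ O x y
    ... | false = incrementHead-join J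
    ... | true
      with runLengths (y ∷ ys) | runLengths-nonempty y ys
         | runLengths (y ∷ ys ++ z ∷ zs) | runLengths-nonempty y (ys ++ z ∷ zs)
    ... | _ | _ , _ , refl | _ | _ , _ , refl = cons J

    runLengths-take-drop : ∀ m xs → 1 ≤ m → m < length xs →
      Join (runLengths (take m xs)) (runLengths (drop m xs))
           (unordered O (take m xs) (drop m xs)) (runLengths xs)
    runLengths-take-drop (suc m) (x ∷ xs) _ (s≤s m<∣xs∣) with drop m xs in eq
    ... | []     = contradiction (trans (cong length (sym eq)) (length-drop m xs))
                                 (<⇒≢ (m<n⇒0<n∸m m<∣xs∣))
    ... | z ∷ zs = subst (λ ws → Join (runLengths (x ∷ take m xs)) (runLengths (z ∷ zs))
                                      (unordered O (x ∷ take m xs) (z ∷ zs)) (runLengths (x ∷ ws)))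
                         (trans (cong (take m xs ++_) (sym eq)) (take++drop≡id m xs))
                         (runLengths-++ x (take m xs) z zs)

    runLengths-halves : ∀ xs → 2 ≤ length xs → let m = ⌊ length xs /2⌋ in
      Join (runLengths (take m xs)) (runLengths (drop m xs))
           (unordered O (take m xs) (drop m xs)) (runLengths xs)
    runLengths-halves xs@(_ ∷ _ ∷ _) _ = runLengths-take-drop _ xs (s≤s z≤n) (⌊n/2⌋<n _)
    runLengths-halves (_ ∷ [])       (s≤s ())

    -- The mergecost along the recursion.

    mergesort-sorted : ∀ {p} xs (a : Acc _<_ (length xs)) → runLengths xs ≡ p ∷ [] →
      mergesort-acc O xs a ≡ (xs , 0)
    mergesort-sorted xs (acc rec) eq with 2 ≤? length xs
    ... | no  _   = refl
    ... | yes 2≤s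
      -- A single run can only arise by gluing two single runs. Both recursive calls therefore
      -- return their halves unchanged, and the check finds no descent.
      with _ , _ , eqˡ , eqʳ , ordered ←
             join-singleton (subst (Join _ _ _) eq (runLengths-halves xs 2≤s))
      rewrite mergesort-sorted (take ⌊ length xs /2⌋ xs) (rec (take-shrinks O xs 2≤s)) eqˡ
            | mergesort-sorted (drop ⌊ length xs /2⌋ xs) (rec (drop-shrinks O xs 2≤s)) eqʳ
            | ordered
            = cong (_, 0) (take++drop≡id ⌊ length xs /2⌋ xs)

    proj₂-if : ∀ {a} {A : Set a} (b : Bool) (x y : A) m n →
      proj₂ (if b then (x , m + n) else (y , m)) ≤ m + n
    proj₂-if true  x y m n = ≤-refl
    proj₂-if false x y m n = m≤m+n m n

    -- Node sizes are bounded by t + 1 because rounding up is then exact: ⌈(t+1)/2⌉ = ⌊t/2⌋ + 1. The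
    -- same bound serves both halves.
    length-takeHalf : ∀ {t} (xs : List Carrier) → length xs ≤ suc t →
      length (take ⌊ length xs /2⌋ xs) ≤ suc ⌊ t /2⌋
    length-takeHalf {t} xs le = begin
      length (take ⌊ length xs /2⌋ xs)   ≡⟨ length-take ⌊ length xs /2⌋ xs ⟩
      ⌊ length xs /2⌋ ⊓ length xs        ≤⟨ m⊓n≤m _ (length xs) ⟩
      ⌊ length xs /2⌋                    ≤⟨ ⌊n/2⌋-mono (m≤n⇒m≤1+n le) ⟩
      suc ⌊ t /2⌋                        ∎

    length-dropHalf : ∀ {t} (xs : List Carrier) → length xs ≤ suc t →
      length (drop ⌊ length xs /2⌋ xs) ≤ suc ⌊ t /2⌋
    length-dropHalf {t} xs le = begin
      length (drop ⌊ length xs /2⌋ xs)   ≡⟨ length-drop ⌊ length xs /2⌋ xs ⟩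
      length xs ∸ ⌊ length xs /2⌋
        ≡⟨ cong (_∸ ⌊ length xs /2⌋) (sym (⌊n/2⌋+⌈n/2⌉≡n (length xs))) ⟩
      ⌊ length xs /2⌋ + ⌈ length xs /2⌉ ∸ ⌊ length xs /2⌋
        ≡⟨ m+n∸m≡n ⌊ length xs /2⌋ ⌈ length xs /2⌉ ⟩
      ⌈ length xs /2⌉                    ≤⟨ ⌈n/2⌉-mono le ⟩
      suc ⌊ t /2⌋                        ∎

    cost : (xs : List Carrier) → Acc _<_ (length xs) → ℕ
    cost xs a = proj₂ (mergesort-acc O xs a)

    -- The merge is charged whatever the check returns, so the contents left by the recursive calls
    -- need no analysis.
    cost-unfold : ∀ xs a → 2 ≤ length xs → let m = ⌊ length xs /2⌋ in
      ∃[ aˡ ] ∃[ aʳ ] cost xs a ≤ cost (take m xs) aˡ + cost (drop m xs) aʳ + length xs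
    cost-unfold xs (acc rec) 2≤s with 2 ≤? length xs
    ... | no  2≰s = contradiction 2≤s 2≰s
    ... | yes 2≤s = aˡ , aʳ , proj₂-if (unordered O ys zs) _ (ys ++ zs) _ (length xs)
      where
      aˡ = rec (take-shrinks O xs 2≤s)
      aʳ = rec (drop-shrinks O xs 2≤s)
      ys = proj₁ (mergesort-acc O (take ⌊ length xs /2⌋ xs) aˡ)
      zs = proj₁ (mergesort-acc O (drop ⌊ length xs /2⌋ xs) aʳ)

    -- A merge on a node of size s costs s, and this is what each of its blocks pays for
    -- the level of the node, unless the node is a single block and already sorted.
    cost≤nodeCost : ∀ h {t} xs a → t ≤ h → length xs ≤ suc t →
      cost xs a ≤ nodeCost 0 0 h t (runLengths xs)
    cost≤nodeCost h       []               (acc _) _   _             = z≤n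
    cost≤nodeCost h       (_ ∷ [])         (acc _) _   _             = z≤n
    cost≤nodeCost zero    (_ ∷ _ ∷ _)      _       z≤n (s≤s ())
    cost≤nodeCost (suc h) {t} xs@(x ∷ y ∷ ys) a t≤1+h le with runLengths-nonempty x (y ∷ ys)
    ... | p , [] , eq =
      ≤-trans (≤-reflexive (cong proj₂ (mergesort-sorted xs a eq))) z≤n
    ... | p , q ∷ ps , eq with aˡ , aʳ , cost≤ ← cost-unfold xs a (s≤s (s≤s z≤n)) = begin
      cost xs a
        ≤⟨ cost≤ ⟩
      cost (take m xs) aˡ + cost (drop m xs) aʳ + length xs
        ≤⟨ +-monoˡ-≤ (length xs) (+-mono-≤
             (cost≤nodeCost h (take m xs) aˡ (⌊t/2⌋≤h t≤1+h) (length-takeHalf xs le))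
             (cost≤nodeCost h (drop m xs) aʳ (⌊t/2⌋≤h t≤1+h) (length-dropHalf xs le))) ⟩
      nodeCost 0 0 h ⌊ t /2⌋ (runLengths (take m xs))
        + nodeCost 0 0 h ⌊ t /2⌋ (runLengths (drop m xs)) + length xs
        ≤⟨ +-monoˡ-≤ (length xs)
             (nodeCost-join 0 0 h ⌊ t /2⌋ (runLengths-halves xs (s≤s (s≤s z≤n)))) ⟩
      nodeCost 0 0 h ⌊ t /2⌋ (runLengths xs) + length xs
        ≡⟨ cong₂ (λ Ls s → nodeCost 0 0 h ⌊ t /2⌋ Ls + s) eq ∣xs∣≡sum ⟩
      nodeCost 0 0 h ⌊ t /2⌋ (p ∷ q ∷ ps) + sum (p ∷ q ∷ ps)
        ≡⟨ +-comm (nodeCost 0 0 h ⌊ t /2⌋ (p ∷ q ∷ ps)) _ ⟩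
      sum (p ∷ q ∷ ps) + nodeCost 0 0 h ⌊ t /2⌋ (p ∷ q ∷ ps)
        ≤⟨ sum+nodeCost≤ h p q ps (subst (All (1 ≤_)) eq (runLengths-positive xs))
             (≤-trans (≤-reflexive (sym ∣xs∣≡sum)) le) ⟩
      nodeCost 0 0 (suc h) t (p ∷ q ∷ ps)
        ≡⟨ cong (nodeCost 0 0 (suc h) t) (sym eq) ⟩
      nodeCost 0 0 (suc h) t (runLengths xs) ∎
      where
      m = ⌊ length xs /2⌋
      ∣xs∣≡sum : length xs ≡ sum (p ∷ q ∷ ps)
      ∣xs∣≡sum = trans (sym (sum-runLengths xs)) (cong sum eq)
      -- Halving a positive t lowers it by at least one, so the level budget `h` lasts.
      ⌊t/2⌋≤h : ∀ {t} → t ≤ suc h → ⌊ t /2⌋ ≤ h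
      ⌊t/2⌋≤h {zero}  _         = z≤n
      ⌊t/2⌋≤h {suc t} (s≤s t≤h) = ≤-trans (s≤s⁻¹ (⌊n/2⌋<n t)) t≤h

    -- A budget of n - 1 levels is generous, but the later bound on `blockCost` is uniform in the
    -- number of levels.
    mergecost≤∑ : ∀ xs → let t = pred (length xs) in
      mergecost O xs ≤ sum (map (λ p → blockCost t 2 p t) (runLengths xs))
    mergecost≤∑ xs = ≤-trans
      (cost≤nodeCost t xs (<-wellFounded (length xs)) ≤-refl (suc-pred-≥ (length xs)))
      (nodeCost≤∑ t t (runLengths xs))
      where
      t = pred (length xs)
      suc-pred-≥ : ∀ n → n ≤ suc (pred n)
      suc-pred-≥ zero    = z≤n
      suc-pred-≥ (suc n) = ≤-refl

open import Data.Integer.Base as ℤ using (+_; -[1+_]; +[1+_])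
import Data.Integer.Properties as ℤ
import Data.Integer.Solver as ℤS
open import Data.List.Base using (List; []; _∷_; map)
open import Data.List.NonEmpty.Base as List⁺ using (List⁺; _∷_)
open import Data.Nat.Base as ℕ using (suc)
open import Data.Nat.ListAction using (sum)
import Data.Nat.Properties as ℕ
import Data.Nat.Solver as ℕS
open import Data.Product.Base using (_,_)
open import Data.Rational.Unnormalised.Base as ℚ using (ℚᵘ; mkℚᵘ; *≤*; *≡*; _≃_)
import Data.Rational.Unnormalised.Properties as ℚ
open import Data.Vec.Properties using (length-toList)
open import Relation.Binary.PropositionalEquality using (_≡_; refl; sym; trans; cong; cong₂; subst)
open import Relation.Nullary using (contradiction)

open import Defs
open import Data.Nat.Base using (ℕ; NonZero)
open import Data.Vec.Base using (Vec; toList)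
open import Relation.Binary.Bundles using (DecTotalOrder)

open Arithmetic using (blockCost; blockCost≤log)
open Counting using (runLengths; sum-runLengths; mergecost≤∑)

-- Passage to rational bounds and Dedekind cuts.

⟦_⟧ : ℕ → ℚᵘ
⟦ k ⟧ = + k ℚ./ 1

⟦⟧-homo-+ : ∀ a b → ⟦ a ℕ.+ b ⟧ ≃ ⟦ a ⟧ ℚ.+ ⟦ b ⟧
⟦⟧-homo-+ a b = *≡* (cong (ℤ._* + 1)
  (cong₂ ℤ._+_ (sym (ℤ.*-identityʳ (+ a))) (sym (ℤ.*-identityʳ (+ b)))))

n*[ℓ/n]≃ℓ : ∀ n ℓ .{{_ : NonZero n}} .{{_ : NonZero ℓ}} →
  ⟦ n ⟧ ℚ.* ℚ⁺.value (ℓ / n) ≃ ⟦ ℓ ⟧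
n*[ℓ/n]≃ℓ n@(suc _) ℓ@(suc _) = *≡*
  (trans (solve 2 (λ n ℓ → n :* ℓ :* con (+ 1) := ℓ :* (con (+ 1) :* n)) refl (+ n) (+ ℓ))
         (cong (+ ℓ ℤ.*_) (sym (ℤ.pos-* 1 n))))
  where open ℤS.+-*-Solver

-- For u = p/e the cut condition reads n^e < 2^p ℓ^e, and the integer bound is divided by e.
blockCost≤ℓ*u+3*ℓ : ∀ u h {n ℓ t} .{{_ : NonZero n}} .{{_ : NonZero ℓ}} → t ℕ.≤ n → ℓ ℕ.≤ n →
  u >ₗ ℚ⁺.value (n / ℓ) → ⟦ blockCost h 2 ℓ t ⟧ ℚ.≤ ⟦ ℓ ⟧ ℚ.* u ℚ.+ ⟦ 3 ℕ.* ℓ ⟧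
blockCost≤ℓ*u+3*ℓ (mkℚᵘ +[1+ p-1 ] e-1) h {n@(suc _)} {ℓ@(suc _)} {t} t≤n ℓ≤n u>log = *≤* (begin
  + B ℤ.* + (1 ℕ.* e ℕ.* 1)
    ≡⟨ sym (ℤ.pos-* B (1 ℕ.* e ℕ.* 1)) ⟩
  + (B ℕ.* (1 ℕ.* e ℕ.* 1))
    ≤⟨ ℤ.+≤+ (ℕ.≤-trans (ℕ.≤-reflexive (solve 2 (λ B e → B :* (con 1 :* e :* con 1) := e :* B) refl B e))
               (ℕ.≤-trans (blockCost≤log e p {h} t≤n n^e<2^p*ℓ^e)
                 (ℕ.≤-reflexive (solve 3 (λ ℓ p e → ℓ :* (p :+ con 3 :* e)
                    := (ℓ :* p :* con 1 :+ con 3 :* ℓ :* (con 1 :* e)) :* con 1) refl ℓ p e)))) ⟩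
  + ((ℓ ℕ.* p ℕ.* 1 ℕ.+ 3 ℕ.* ℓ ℕ.* (1 ℕ.* e)) ℕ.* 1)
    ≡⟨ ℤ.pos-* (ℓ ℕ.* p ℕ.* 1 ℕ.+ 3 ℕ.* ℓ ℕ.* (1 ℕ.* e)) 1 ⟩
  (+ (ℓ ℕ.* p ℕ.* 1) ℤ.+ + (3 ℕ.* ℓ ℕ.* (1 ℕ.* e))) ℤ.* + 1
    ≡⟨ cong (ℤ._* + 1) (cong₂ ℤ._+_
         (trans (ℤ.pos-* (ℓ ℕ.* p) 1) (cong (ℤ._* + 1) (ℤ.pos-* ℓ p)))
         (ℤ.pos-* (3 ℕ.* ℓ) (1 ℕ.* e))) ⟩
  (+ ℓ ℤ.* + p ℤ.* + 1 ℤ.+ + (3 ℕ.* ℓ) ℤ.* + (1 ℕ.* e)) ℤ.* + 1 ∎)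
  where
  open ℤ.≤-Reasoning
  open ℕS.+-*-Solver
  e = suc e-1
  p = suc p-1
  B = blockCost h 2 ℓ t
  n^e<2^p*ℓ^e : n ℕ.^ e ℕ.< 2 ℕ.^ p ℕ.* ℓ ℕ.^ e
  n^e<2^p*ℓ^e = subst (ℕ._< 2 ℕ.^ p ℕ.* ℓ ℕ.^ e) (ℕ.*-identityˡ (n ℕ.^ e)) u>log
-- No u ≤ 0 lies above the logarithm, since ℓ ≤ n.
blockCost≤ℓ*u+3*ℓ (mkℚᵘ (+ 0) e-1) h {n@(suc _)} {ℓ@(suc _)} t≤n ℓ≤n u>log =
  contradiction u>log (ℕ.≤⇒≯ (ℕ.*-monoʳ-≤ 1 (ℕ.^-monoˡ-≤ (suc e-1) ℓ≤n)))
blockCost≤ℓ*u+3*ℓ (mkℚᵘ -[1+ p-1 ] e-1) h {n@(suc _)} {ℓ@(suc _)} t≤n ℓ≤n u>log =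
  contradiction u>log (ℕ.≤⇒≯ (ℕ.*-mono-≤ (ℕ.m^n>0 2 (suc p-1)) (ℕ.^-monoˡ-≤ (suc e-1) ℓ≤n)))

-- A rational above the entropy comes with rationals above the single logarithms, one per run;
-- multiplying by n turns the weights ℓ/n into ℓ. The total length is only bounded by n so that the
-- hypothesis passes to tails.
∑blockCost≤entropy : ∀ {a} {A : Set a} h n {t r} .{{_ : NonZero n}} (Rs : List (List⁺ A)) → t ℕ.≤ n →
  sum (map List⁺.length Rs) ℕ.≤ n → ℝ.U (entropy n Rs) r →
  ⟦ sum (map (λ ℓ → blockCost h 2 ℓ t) (map List⁺.length Rs)) ⟧
    ℚ.≤ ⟦ n ⟧ ℚ.* r ℚ.+ ⟦ 3 ℕ.* sum (map List⁺.length Rs) ⟧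
∑blockCost≤entropy h n@(suc _) {t} {r} [] t≤n ∑≤n 0<r = begin
  ⟦ 0 ⟧                      ≃⟨ ℚ.≃-sym (ℚ.*-zeroʳ ⟦ n ⟧) ⟩
  ⟦ n ⟧ ℚ.* ⟦ 0 ⟧            ≤⟨ ℚ.*-monoʳ-≤-nonNeg ⟦ n ⟧ (ℚ.<⇒≤ 0<r) ⟩
  ⟦ n ⟧ ℚ.* r                ≃⟨ ℚ.≃-sym (ℚ.+-identityʳ (⟦ n ⟧ ℚ.* r)) ⟩
  ⟦ n ⟧ ℚ.* r ℚ.+ ⟦ 0 ⟧      ∎
  where open ℚ.≤-Reasoning
∑blockCost≤entropy h n@(suc _) {t} {r} (R@(x ∷ xs) ∷ Rs) t≤n ∑≤n
  (a , b , (u , u>log , [ℓ/n]*u≤a) , b>entropy , a+b≤r) = begin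
  ⟦ B ℕ.+ S ⟧
    ≃⟨ ⟦⟧-homo-+ B S ⟩
  ⟦ B ⟧ ℚ.+ ⟦ S ⟧
    ≤⟨ ℚ.+-mono-≤ (blockCost≤ℓ*u+3*ℓ u h t≤n (ℕ.m+n≤o⇒m≤o ℓ ∑≤n) u>log)
                  (∑blockCost≤entropy h n Rs t≤n (ℕ.m+n≤o⇒n≤o ℓ ∑≤n) b>entropy) ⟩
  (⟦ ℓ ⟧ ℚ.* u ℚ.+ ⟦ 3 ℕ.* ℓ ⟧) ℚ.+ (⟦ n ⟧ ℚ.* b ℚ.+ ⟦ 3 ℕ.* s ⟧)
    ≃⟨ interchange (⟦ ℓ ⟧ ℚ.* u) ⟦ 3 ℕ.* ℓ ⟧ (⟦ n ⟧ ℚ.* b) ⟦ 3 ℕ.* s ⟧ ⟩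
  (⟦ ℓ ⟧ ℚ.* u ℚ.+ ⟦ n ⟧ ℚ.* b) ℚ.+ (⟦ 3 ℕ.* ℓ ⟧ ℚ.+ ⟦ 3 ℕ.* s ⟧)
    ≃⟨ ℚ.+-cong (ℚ.+-congˡ (⟦ n ⟧ ℚ.* b) (ℚ.≃-sym n*[[ℓ/n]*u]≃ℓ*u))
                (ℚ.≃-trans (ℚ.≃-sym (⟦⟧-homo-+ (3 ℕ.* ℓ) (3 ℕ.* s)))
                           (ℚ.≃-reflexive (cong ⟦_⟧ (sym (ℕ.*-distribˡ-+ 3 ℓ s))))) ⟩
  (⟦ n ⟧ ℚ.* (ℓ/n ℚ.* u) ℚ.+ ⟦ n ⟧ ℚ.* b) ℚ.+ ⟦ 3 ℕ.* (ℓ ℕ.+ s) ⟧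
    ≃⟨ ℚ.+-congˡ ⟦ 3 ℕ.* (ℓ ℕ.+ s) ⟧ (ℚ.≃-sym (ℚ.*-distribˡ-+ ⟦ n ⟧ (ℓ/n ℚ.* u) b)) ⟩
  ⟦ n ⟧ ℚ.* (ℓ/n ℚ.* u ℚ.+ b) ℚ.+ ⟦ 3 ℕ.* (ℓ ℕ.+ s) ⟧
    ≤⟨ ℚ.+-monoˡ-≤ ⟦ 3 ℕ.* (ℓ ℕ.+ s) ⟧ (ℚ.*-monoʳ-≤-nonNeg ⟦ n ⟧
         (ℚ.≤-trans (ℚ.+-monoˡ-≤ b [ℓ/n]*u≤a) a+b≤r)) ⟩
  ⟦ n ⟧ ℚ.* r ℚ.+ ⟦ 3 ℕ.* (ℓ ℕ.+ s) ⟧ ∎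
  where
  open ℚ.≤-Reasoning
  ℓ = List⁺.length R
  ℓ/n = ℚ⁺.value (ℓ / n)
  s = sum (map List⁺.length Rs)
  B = blockCost h 2 ℓ t
  S = sum (map (λ ℓ → blockCost h 2 ℓ t) (map List⁺.length Rs))
  n*[[ℓ/n]*u]≃ℓ*u : ⟦ n ⟧ ℚ.* (ℓ/n ℚ.* u) ≃ ⟦ ℓ ⟧ ℚ.* u
  n*[[ℓ/n]*u]≃ℓ*u = ℚ.≃-trans (ℚ.≃-sym (ℚ.*-assoc ⟦ n ⟧ ℓ/n u)) (ℚ.*-congʳ {u} (n*[ℓ/n]≃ℓ n ℓ))

mainTheorem1 : ∀ {c ℓ₁ ℓ₂} (O : DecTotalOrder c ℓ₁ ℓ₂) (n : ℕ) .{{_ : NonZero n}}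
    (A : Vec (DecTotalOrder.Carrier O) n) →
    fromℕ (mergecost O (toList A)) ≤ n / 1 • (entropy n (runs O (toList A)) + fromℕ 3)
-- The real order `≤` is a negated `<`, so a rational q lying above (H + 3)n and below M is given;
-- the chain refutes it by proving M ≤ q.
mainTheorem1 O n@(suc n-1) A (q , (r , (r₁ , r₂ , r₁>entropy , 3<r₂ , r₁+r₂≤r) , n*r≤q) , q<M) =
  ℚ.<-irrefl ℚ.≃-refl (begin-strict
    ⟦ M ⟧
      ≤⟨ *≤* (ℤ.*-monoʳ-≤-nonNeg (+ 1) (ℤ.+≤+
           (subst (λ s → M ℕ.≤ sum (map (λ p → blockCost (ℕ.pred s) 2 p (ℕ.pred s)) (runLengths O xs)))
                  (length-toList A) (mergecost≤∑ O xs)))) ⟩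
    ⟦ sum (map (λ p → blockCost n-1 2 p n-1) (runLengths O xs)) ⟧
      ≤⟨ ∑blockCost≤entropy n-1 n (runs O xs) (ℕ.n≤1+n n-1) (ℕ.≤-reflexive ∑≡n) r₁>entropy ⟩
    ⟦ n ⟧ ℚ.* r₁ ℚ.+ ⟦ 3 ℕ.* sum (runLengths O xs) ⟧
      ≃⟨ ℚ.+-congʳ (⟦ n ⟧ ℚ.* r₁) 3*∑≃n*3 ⟩
    ⟦ n ⟧ ℚ.* r₁ ℚ.+ ⟦ n ⟧ ℚ.* ⟦ 3 ⟧
      ≃⟨ ℚ.≃-sym (ℚ.*-distribˡ-+ ⟦ n ⟧ r₁ ⟦ 3 ⟧) ⟩
    ⟦ n ⟧ ℚ.* (r₁ ℚ.+ ⟦ 3 ⟧)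
      ≤⟨ ℚ.*-monoʳ-≤-nonNeg ⟦ n ⟧ (ℚ.≤-trans (ℚ.+-monoʳ-≤ r₁ (ℚ.<⇒≤ 3<r₂)) r₁+r₂≤r) ⟩
    ⟦ n ⟧ ℚ.* r
      ≤⟨ n*r≤q ⟩
    q
      <⟨ q<M ⟩
    ⟦ M ⟧ ∎)
  where
  open ℚ.≤-Reasoning
  xs = toList A
  M = mergecost O xs
  ∑≡n : sum (runLengths O xs) ≡ n
  ∑≡n = trans (sum-runLengths O xs) (length-toList A)
  3*∑≃n*3 : ⟦ 3 ℕ.* sum (runLengths O xs) ⟧ ≃ ⟦ n ⟧ ℚ.* ⟦ 3 ⟧
  3*∑≃n*3 = *≡* (cong (ℤ._* + 1)
    (trans (cong (λ z → + (3 ℕ.* z)) ∑≡n) (trans (cong +_ (ℕ.*-comm 3 n)) (ℤ.pos-* n 3))))
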